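{- Let $n\ge 1$ and $k$ be integers with $\lfloor n/2\rfloor \le k\le \lfloor (2n-2)/3\rfloor$. Then the cube polynomial of $\Phi^n_k$ is $$C(\Phi^n_k,x)=\sum_{j\ge 0}\binom{n-k-j-1}{2k-n+1}\binom{2k-n+1}{j}x^j.$$
   Context: A subword of a word is a block of consecutive letters. A binary word (over $\{0,1\}$) of length $n\ge 1$ is Padovan if it starts and ends with $0$, contains no subword $00$, and contains no subword $111$. For $n\ge1$ and $\lfloor n/2\rfloor\le k\le\lfloor(2n-2)/3\rfloor$, the weighted Padovan graph $\Phi^n_k$ is the simple graph whose vertices are all Padovan words of length $n$ with exactly $k$ letters $1$; two vertices are adjacent if one can be obtained from the other by replacing exactly one subword $01$ with $10$. The cube polynomial of a finite graph $G$ is $C(G,x)=\sum_{m\ge0}c_m(G)x^m$, where $c_m(G)$ is the number of induced subgraphs of $G$ isomorphic to the $m$-dimensional hypercube $Q_m$ (so $c_0(G)=|V(G)|$, $c_1(G)=|E(G)|$). Binomial coefficients $\binom{m}{r}$ are $0$ unless $0\le r\le m$. -}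

module Defs where

open import Data.Empty using (⊥; ⊥-elim-irr)
open import Data.Fin.Base as Fin using (Fin)
open import Data.Fin.Patterns using (0F; 1F)
import Data.Fin.Properties as Finₚ
open import Data.Fin.Subset using (Subset; _∈_)
open import Data.Fin.Subset.Properties using (_∈?_)
open import Data.Integer.Base as ℤ using (ℤ; +_; -[1+_])
open import Data.Irrelevant using ([_])
open import Data.List.Base as List using (List; []; _∷_; _++_)
import Data.List.Membership.Propositional as ListMembership
open import Data.List.Membership.Propositional.Properties
  using (∈-filter⁺; ∈-filter⁻; ∈-allFin; ∈-lookup)
open import Data.List.Properties using (++-cancelˡ; ∷-injectiveˡ; ≡-dec)
open import Data.List.Relation.Binary.Infix.Heterogeneous using (Infix)
open import Data.List.Relation.Binary.Infix.Heterogeneous.Properties using (infix?)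
open import Data.List.Relation.Binary.Prefix.Heterogeneous using (Prefix)
open import Data.List.Relation.Binary.Prefix.Heterogeneous.Properties using (prefix?)
open import Data.List.Relation.Binary.Suffix.Heterogeneous using (Suffix)
open import Data.List.Relation.Binary.Suffix.Heterogeneous.Properties using (suffix?)
import Data.List.Relation.Unary.All as All
import Data.List.Relation.Unary.AllPairs.Core as AllPairs
open import Data.List.Relation.Unary.Any using (index)
open import Data.List.Relation.Unary.Any.Properties using (lookup-index)
open import Data.List.Relation.Unary.Unique.Propositional using (Unique)
import Data.List.Relation.Unary.Unique.Propositional.Properties as Uniqueₚ
open import Data.Nat.Base as ℕ using (ℕ; zero; suc; _<_)
open import Data.Nat.Combinatorics using (_C_; k>n⇒nCk≡0)
import Data.Nat.Properties as ℕₚ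
open import Data.Product using (∃; ∃₂; ∃!; _×_; _,_; proj₁; proj₂; uncurry)
open import Data.Product.Function.NonDependent.Propositional using (_×-↔_)
open import Data.Refinement using (Refinement-syntax; _,_; value; value-injective)
open import Data.Sum.Base using (_⊎_; inj₁; inj₂)
open import Data.Unit.Base using (tt)
open import Data.Vec.Base as Vec using (Vec; []; _∷_; lookup; tabulate; toList; count; _[_]≔_; replicate)
open import Data.Vec.Properties using (lookup∘tabulate; lookup∘update; lookup∘update′; lookup-replicate)
open import Function.Base using (_∘_; _on_)
open import Function.Bundles using (_↔_; _⇔_; mk↔ₛ′; mk⇔; module Inverse; module Equivalence)
open import Function.Properties.Inverse using (↔-refl; ↔-sym; ↔-trans)
open import Relation.Binary.Construct.Closure.Symmetric as SymClosure using (SymClosure; fwd; bwd)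
open import Relation.Binary.Core using (Rel)
open import Relation.Binary.Definitions using (Symmetric; Irreflexive; DecidableEquality)
  renaming (Decidable to Decidable₂)
open import Relation.Binary.PropositionalEquality
  using (_≡_; _≢_; refl; sym; trans; cong; subst)
open import Relation.Nullary using (¬_; Dec; yes; no; contradiction)
open import Relation.Nullary.Decidable using (map′; _×-dec_; _⊎-dec_; _→-dec_; ¬?; recompute)
open import Relation.Unary using (Decidable)
open import Level using (0ℓ)

private
  variable
    A : Set

record Finite (A : Set) : Set where
  field
    size : ℕ
    enum : Fin size ↔ A

  private module E = Inverse enum

  element : Fin size → A
  element = E.to

  position : A → Fin size
  position = E.from

  element-position : ∀ a → element (position a) ≡ a
  element-position = E.strictlyInverseˡ

  position-element : ∀ i → position (element i) ≡ i
  position-element = E.strictlyInverseʳ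

  position-injective : ∀ {a b} → position a ≡ position b → a ≡ b
  position-injective {a} {b} eq =
    trans (sym (element-position a)) (trans (cong element eq) (element-position b))

  _≟_ : DecidableEquality A
  a ≟ b = map′ position-injective (cong position) (position a Finₚ.≟ position b)

  ∃? : {P : A → Set} → Decidable P → Dec (∃ P)
  ∃? {P} P? = map′ (λ (i , p) → element i , p)
                   (λ (a , p) → position a , subst P (sym (element-position a)) p)
                   (Finₚ.any? (P? ∘ element))

  ∀? : {P : A → Set} → Decidable P → Dec (∀ a → P a)
  ∀? {P} P? = map′ (λ h a → subst P (element-position a) (h (position a)))
                   (λ h i → h (element i))
                   (Finₚ.all? (P? ∘ element))

open Finite using (size; enum)

Fin-finite : ∀ n → Finite (Fin n)
Fin-finite n = record { size = n ; enum = ↔-refl }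

Vec-finite : Finite A → ∀ n → Finite (Vec A n)
Vec-finite F zero = record
  { size = 1
  ; enum = ↔-trans Finₚ.1↔⊤ (mk↔ₛ′ (λ _ → []) (λ _ → tt) (λ { [] → refl }) (λ _ → refl))
  }
Vec-finite F (suc n) = record
  { size = size F ℕ.* size Fⁿ
  ; enum = ↔-trans Finₚ.*↔× (↔-trans (enum F ×-↔ enum Fⁿ)
             (mk↔ₛ′ (uncurry _∷_) (λ v → Vec.head v , Vec.tail v)
                    (λ { (_ ∷ _) → refl }) (λ _ → refl)))
  }
  where Fⁿ = Vec-finite F n

private
  lookup-injective : {xs : List A} → Unique xs → ∀ i j →
                     List.lookup xs i ≡ List.lookup xs j → i ≡ j
  lookup-injective (_ AllPairs.∷ _)  Fin.zero    Fin.zero    _  = refl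
  lookup-injective {xs = _ ∷ xs} (d AllPairs.∷ _) Fin.zero (Fin.suc j) eq =
    contradiction eq (All.lookup d (∈-lookup {xs = xs} j))
  lookup-injective {xs = _ ∷ xs} (d AllPairs.∷ _) (Fin.suc i) Fin.zero eq =
    contradiction (sym eq) (All.lookup d (∈-lookup {xs = xs} i))
  lookup-injective (_ AllPairs.∷ u) (Fin.suc i) (Fin.suc j) eq =
    cong Fin.suc (lookup-injective u i j eq)

refine-finite : Finite A → {P : A → Set} → Decidable P → Finite [ a ∈ A ∣ P a ]
refine-finite {A} F {P} P? = record
  { size = List.length xs
  ; enum = mk↔ₛ′ to from to∘from from∘to
  }
  where
  open Finite F using (element; position; element-position; position-element)

  P∘? : Decidable (P ∘ element)
  P∘? i = P? (element i)

  xs : List (Fin (size F))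
  xs = List.filter P∘? (List.allFin (size F))

  to : Fin (List.length xs) → [ a ∈ A ∣ P a ]
  to i = element (List.lookup xs i)
       , [ proj₂ (∈-filter⁻ P∘? {xs = List.allFin (size F)} (∈-lookup {xs = xs} i)) ]

  position∈ : (a : [ a ∈ A ∣ P a ]) → position (value a) ListMembership.∈ xs
  position∈ (a , [ p ]) = ∈-filter⁺ P∘? (∈-allFin (position a))
    (subst P (sym (element-position a)) (recompute (P? a) p))

  from : [ a ∈ A ∣ P a ] → Fin (List.length xs)
  from a = index (position∈ a)

  to∘from : ∀ a → to (from a) ≡ a
  to∘from a = value-injective
    (trans (cong element (sym (lookup-index (position∈ a)))) (element-position (value a)))

  from∘to : ∀ i → from (to i) ≡ i
  from∘to i = lookup-injective (Uniqueₚ.filter⁺ P∘? (Uniqueₚ.allFin⁺ (size F))) _ _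
    (trans (sym (lookup-index (position∈ (to i)))) (position-element (List.lookup xs i)))

record Graph : Set₁ where
  field
    Vertex   : Set
    vertices : Finite Vertex
    _~_      : Rel Vertex 0ℓ
    _~?_     : Decidable₂ _~_
    ~-sym    : Symmetric _~_
    ~-irrefl : Irreflexive _≡_ _~_

  order : ℕ
  order = size vertices

open Graph using (vertices; order)

infix 4 _≅_ _≅?_
record _≅_ (G H : Graph) : Set where
  private
    module G = Graph G
    module H = Graph H
  field
    bijection : G.Vertex ↔ H.Vertex
  open Inverse bijection using (to)
  field
    adjacency : ∀ u v → (u G.~ v) ⇔ (to u H.~ to v)

_≅?_ : (G H : Graph) → Dec (G ≅ H)
G ≅? H = map′ fromVecs toVecs
  (FG.∃? λ f → FH.∃? λ g →
    VG.∀? (λ v → app′ g (app f v) VG.≟ v) ×-dec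
    VH.∀? (λ w → app f (app′ g w) VH.≟ w) ×-dec
    VG.∀? (λ u → VG.∀? λ v → (u G.~? v) ⇔-dec (app f u H.~? app f v)))
  where
  module G  = Graph G
  module H  = Graph H
  module VG = Finite G.vertices
  module VH = Finite H.vertices
  module FG = Finite (Vec-finite H.vertices G.order)
  module FH = Finite (Vec-finite G.vertices H.order)

  _⇔-dec_ : ∀ {P Q : Set} → Dec P → Dec Q → Dec (P ⇔ Q)
  p? ⇔-dec q? = map′ (λ (f , g) → mk⇔ f g) (λ e → Equivalence.to e , Equivalence.from e)
                     ((p? →-dec q?) ×-dec (q? →-dec p?))

  app : Vec H.Vertex G.order → G.Vertex → H.Vertex
  app f v = lookup f (VG.position v)

  app′ : Vec G.Vertex H.order → H.Vertex → G.Vertex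
  app′ g w = lookup g (VH.position w)

  Witness : Set
  Witness = ∃ λ f → ∃ λ g →
    (∀ v → app′ g (app f v) ≡ v) × (∀ w → app f (app′ g w) ≡ w) ×
    (∀ u v → (u G.~ v) ⇔ (app f u H.~ app f v))

  fromVecs : Witness → G ≅ H
  fromVecs (f , g , gf , fg , adj) = record
    { bijection = mk↔ₛ′ (app f) (app′ g) fg gf
    ; adjacency = adj
    }

  toVecs : G ≅ H → Witness
  toVecs iso = f , g , gf , fg , adj
    where
    open _≅_ iso
    open Inverse bijection using (to; from; strictlyInverseˡ; strictlyInverseʳ)

    f = tabulate (to ∘ VG.element)
    g = tabulate (from ∘ VH.element)

    app-f : ∀ v → app f v ≡ to v
    app-f v = trans (lookup∘tabulate (to ∘ VG.element) (VG.position v)) (cong to (VG.element-position v))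

    app-g : ∀ w → app′ g w ≡ from w
    app-g w = trans (lookup∘tabulate (from ∘ VH.element) (VH.position w)) (cong from (VH.element-position w))

    gf : ∀ v → app′ g (app f v) ≡ v
    gf v = trans (app-g _) (trans (cong from (app-f v)) (strictlyInverseʳ v))

    fg : ∀ w → app f (app′ g w) ≡ w
    fg w = trans (app-f _) (trans (cong to (app-g w)) (strictlyInverseˡ w))

    adj : ∀ u v → (u G.~ v) ⇔ (app f u H.~ app f v)
    adj u v rewrite app-f u | app-f v = adjacency u v

-- A set of vertices is encoded as the set of their positions in the
-- enumeration of the vertices.
induced : (G : Graph) → Subset (order G) → Graph
induced G S = record
  { Vertex   = [ v ∈ G.Vertex ∣ Finite.position G.vertices v ∈ S ]
  ; vertices = refine-finite G.vertices (λ v → Finite.position G.vertices v ∈? S)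
  ; _~_      = G._~_ on value
  ; _~?_     = λ u v → value u G.~? value v
  ; ~-sym    = G.~-sym
  ; ~-irrefl = λ u≡v → G.~-irrefl (cong value u≡v)
  }
  where module G = Graph G

Subset-finite : ∀ n → Finite (Subset n)
Subset-finite = Vec-finite (record { size = 2 ; enum = Finₚ.2↔Bool })

binaryWords : ∀ n → Finite (Vec (Fin 2) n)
binaryWords = Vec-finite (Fin-finite 2)

Q : ℕ → Graph
Q m = record
  { Vertex   = Vec (Fin 2) m
  ; vertices = binaryWords m
  ; _~_      = λ u v → ∃! _≡_ λ i → lookup u i ≢ lookup v i
  ; _~?_     = λ u v → Finₚ.any? λ i → differ? u v i ×-dec
                 map′ (λ h {j} → h j) (λ h j → h {j})
                   (Finₚ.all? λ j → differ? u v j →-dec (i Finₚ.≟ j))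
  ; ~-sym    = λ (i , u≢v , unique) → i , u≢v ∘ sym , λ v≢u → unique (v≢u ∘ sym)
  ; ~-irrefl = λ { refl (i , u≢u , _) → u≢u refl }
  }
  where
  differ? : ∀ (u v : Vec (Fin 2) m) i → Dec (lookup u i ≢ lookup v i)
  differ? u v i = ¬? (lookup u i Finₚ.≟ lookup v i)

FinitelySupported : (ℕ → ℕ) → Set
FinitelySupported a = ∃ λ d → ∀ j → d < j → a j ≡ 0

-- The polynomial Σ_{j≥0} a j · x^j.
record Polynomial : Set where
  constructor polynomial
  field
    coeff   : ℕ → ℕ
    support : FinitelySupported coeff

open Polynomial using (coeff)

infix 4 _≈_
_≈_ : Rel Polynomial 0ℓ
p ≈ q = ∀ j → coeff p j ≡ coeff q j

-- Membership proofs in a refinement are irrelevant, so each vertex set is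
-- counted once, however many isomorphisms with Q m there are.
inducedCubes : (G : Graph) (m : ℕ) → Finite [ S ∈ Subset (order G) ∣ induced G S ≅ Q m ]
inducedCubes G m = refine-finite (Subset-finite (order G)) (λ S → induced G S ≅? Q m)

cubeCount : ℕ → Graph → ℕ
cubeCount m G = size (inducedCubes G m)

private
  empty⇒size≡0 : (F : Finite A) → (A → ⊥) → size F ≡ 0
  empty⇒size≡0 F ¬a with size F in eq
  ... | zero  = refl
  ... | suc n = contradiction (Finite.element F (subst Fin (sym eq) Fin.zero)) ¬a

  unit : ∀ {m} → Fin m → Vec (Fin 2) m
  unit i = replicate _ 0F [ i ]≔ 1F

  unit-injective : ∀ {m} (i j : Fin m) → unit i ≡ unit j → i ≡ j
  unit-injective i j eq with i Finₚ.≟ j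
  ... | yes i≡j = i≡j
  ... | no  i≢j = contradiction
    (trans (sym (lookup∘update i (replicate _ 0F) 1F))
      (trans (cong (λ v → lookup v i) eq)
        (trans (lookup∘update′ i≢j (replicate _ 0F) 1F) (lookup-replicate i 0F))))
    (λ ())

  cube-bound : ∀ G S m → order G < m → ¬ (induced G S ≅ Q m)
  cube-bound G S m G<m iso with Finₚ.pigeonhole G<m (position ∘ value ∘ from ∘ unit)
    where
    open Finite (vertices G) using (position)
    open Inverse (_≅_.bijection iso) using (from)
  ... | i , j , i<j , eq = Finₚ.<⇒≢ i<j (unit-injective i j
    (trans (sym (strictlyInverseˡ _)) (trans (cong to (value-injective (position-injective eq)))
      (strictlyInverseˡ _))))
    where
    open Finite (vertices G) using (position-injective)
    open Inverse (_≅_.bijection iso) using (to; strictlyInverseˡ)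

cubePolynomial : Graph → Polynomial
cubePolynomial G = polynomial (λ m → cubeCount m G)
  ( order G
  , λ m G<m → empty⇒size≡0 (inducedCubes G m)
                (λ { (S , [ iso ]) → ⊥-elim-irr (cube-bound G S m G<m iso) }))

_hasSubword_ : List (Fin 2) → List (Fin 2) → Set
w hasSubword s = Infix _≡_ s w

Padovan : List (Fin 2) → Set
Padovan w = Prefix _≡_ (0F ∷ []) w
          × Suffix _≡_ (0F ∷ []) w
          × ¬ (w hasSubword (0F ∷ 0F ∷ []))
          × ¬ (w hasSubword (1F ∷ 1F ∷ 1F ∷ []))

Padovan? : Decidable Padovan
Padovan? w = prefix? Finₚ._≟_ _ w
       ×-dec suffix? Finₚ._≟_ _ w
       ×-dec ¬? (infix? Finₚ._≟_ _ w)
       ×-dec ¬? (infix? Finₚ._≟_ _ w)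

ones : ∀ {n} → Vec (Fin 2) n → ℕ
ones = count (Finₚ._≟ 1F)

infix 4 _⟶_ _⟶?_
_⟶_ : Rel (List (Fin 2)) 0ℓ
u ⟶ v = ∃₂ λ a b → u ≡ a ++ 0F ∷ 1F ∷ b × v ≡ a ++ 1F ∷ 0F ∷ b

_⟶?_ : Decidable₂ _⟶_
u ⟶? v = map′ to (from u v) (step? u v)
  where
  data Step : Rel (List (Fin 2)) 0ℓ where
    here  : ∀ {b} → Step (0F ∷ 1F ∷ b) (1F ∷ 0F ∷ b)
    there : ∀ {x u v} → Step u v → Step (x ∷ u) (x ∷ v)

  to : ∀ {u v} → Step u v → u ⟶ v
  to here = [] , _ , refl , refl
  to (there {x} s) with a , b , refl , refl ← to s = x ∷ a , b , refl , refl

  from : ∀ u v → u ⟶ v → Step u v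
  from _ _ ([]    , b , refl , refl) = here
  from _ _ (x ∷ a , b , refl , refl) = there (from _ _ (a , b , refl , refl))

  stepList? : Decidable₂ (_≡_ {A = List (Fin 2)})
  stepList? = ≡-dec Finₚ._≟_

  step? : Decidable₂ Step
  step? []       _        = no λ ()
  step? (_ ∷ _)  []       = no λ ()
  step? (0F ∷ u) (0F ∷ v) = map′ there (λ { (there s) → s }) (step? u v)
  step? (1F ∷ u) (1F ∷ v) = map′ there (λ { (there s) → s }) (step? u v)
  step? (1F ∷ _) (0F ∷ _) = no λ ()
  step? (0F ∷ []) (1F ∷ _) = no λ ()
  step? (0F ∷ 0F ∷ _) (1F ∷ _) = no λ ()
  step? (0F ∷ 1F ∷ _) (1F ∷ []) = no λ ()
  step? (0F ∷ 1F ∷ _) (1F ∷ 1F ∷ _) = no λ ()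
  step? (0F ∷ 1F ∷ u) (1F ∷ 0F ∷ v) =
    map′ (λ { refl → here }) (λ { here → refl }) (stepList? u v)

private
  ⟶-irrefl : ∀ u → ¬ (u ⟶ u)
  ⟶-irrefl u (a , b , u≡ , u≡′) =
    contradiction (∷-injectiveˡ (++-cancelˡ a _ _ (trans (sym u≡) u≡′))) (λ ())

Φ : (n k : ℕ) → Graph
Φ n k = record
  { Vertex   = [ w ∈ Vec (Fin 2) n ∣ Padovan (toList w) × ones w ≡ k ]
  ; vertices = refine-finite (binaryWords n) (λ w → Padovan? (toList w) ×-dec (ones w ℕₚ.≟ k))
  ; _~_      = SymClosure _⟶_ on letters
  ; _~?_     = λ u v → map′ (λ { (inj₁ s) → fwd s ; (inj₂ s) → bwd s })
                            (λ { (fwd s) → inj₁ s ; (bwd s) → inj₂ s })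
                            ((letters u ⟶? letters v) ⊎-dec (letters v ⟶? letters u))
  ; ~-sym    = SymClosure.symmetric _⟶_
  ; ~-irrefl = λ { refl (fwd s) → ⟶-irrefl _ s ; refl (bwd s) → ⟶-irrefl _ s }
  }
  where
  letters : [ w ∈ Vec (Fin 2) n ∣ Padovan (toList w) × ones w ≡ k ] → List (Fin 2)
  letters = toList ∘ value

-- The arguments are integers, so that n-k-j-1 and 2k-n+1 are not truncated.
_choose_ : ℤ → ℤ → ℕ
(+ m)    choose (+ r)    = m C r
(+ _)    choose -[1+ _ ] = 0
-[1+ _ ] choose _        = 0

choose-support : ∀ (a : ℕ → ℕ) p → FinitelySupported (λ j → a j ℕ.* (p choose (+ j)))
choose-support a p = ℤ.∣ p ∣ , λ j p<j → trans (cong (a j ℕ.*_) (vanish p j p<j)) (ℕₚ.*-zeroʳ (a j))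
  where
  vanish : ∀ p j → ℤ.∣ p ∣ < j → p choose (+ j) ≡ 0
  vanish (+ m)    j m<j = k>n⇒nCk≡0 m<j
  vanish -[1+ _ ] j _   = refl

{-# OPTIONS --safe #-}
-- A Padovan word is 0 1^{a₁} 0 1^{a₂} 0 ⋯ 0 with all aᵢ ∈ {1, 2}. Recording
-- which aᵢ are 2 identifies Φ n k with the graph of binary words of length
-- s = n - k - 1 with p = 2k - n + 1 ones, adjacent when they differ by a
-- transposition of neighbouring letters. The vector of prefix sums embeds
-- that graph in the grid ℤ^s, where opposite edges of a 4-cycle are parallel,
-- hence so are all edges of a cube in one direction. By induction on m, an
-- m-cube therefore consists of the words obtained by swapping independently
-- inside m disjoint blocks 01: it is a word with p - m letters 1, m letters
-- X = {01, 10} and s - p - m letters 0. Of these s - m letters, p are not 0,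
-- and m of those p are X, which gives C(s - m, p) C(p, m) cubes.
module Submission where

open import Defs
open import Data.Integer.Base using (+_; _+_; _-_)
open import Data.Nat.Base as ℕ using (ℕ; _≤_; _∸_; _/_)

open import Algebra.Bundles using (module AbelianGroup)
import Algebra.Properties.Group as Groupₚ
open import Data.Bool.Base using (Bool; true; false)
open import Data.Empty using (⊥-elim)
open import Data.Fin.Base using (Fin; zero; suc)
open import Data.Fin.Patterns using (0F; 1F)
open import Data.Fin.Permutation using (↔⇒≡)
import Data.Fin.Properties as Finₚ
open import Data.Fin.Subset using (Subset) renaming (_∈_ to _∈ₛ_)
open import Data.Fin.Subset.Properties using (⊆-antisym) renaming (_∈?_ to _∈ₛ?_)
open import Data.Integer.Base using (ℤ; -_; 0ℤ; 1ℤ; -1ℤ)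
import Data.Integer.Properties as ℤₚ
import Data.Integer.Tactic.RingSolver as ℤ-Solver
open import Data.Irrelevant using ([_])
open import Data.List.Base using (List; []; _∷_; length)
open import Data.List.Properties using (∷-injective; ∷-injectiveʳ)
open import Data.List.Relation.Binary.Infix.Heterogeneous using (here; there)
open import Data.List.Relation.Binary.Pointwise using ([]; _∷_)
open import Data.List.Relation.Binary.Prefix.Heterogeneous using (Prefix; []; _∷_)
open import Data.List.Relation.Binary.Suffix.Heterogeneous using (Suffix; here; there)
open import Data.Maybe.Base using (Maybe; just; nothing)
open import Data.Nat.Base using (zero; suc; _<_; _%_; s≤s⁻¹)
open import Data.Nat.Combinatorics using (_C_; nCk+nC[k+1]≡[n+1]C[k+1])
import Data.Nat.DivMod as DivMod
import Data.Nat.Properties as ℕₚ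
import Data.Nat.Tactic.RingSolver as ℕ-Solver
open import Data.Product using (∃; ∃₂; ∃!; Σ; _×_; _,_; proj₁; proj₂)
open import Data.Refinement using (Refinement-syntax; _,_; value; value-injective)
open import Data.Sum.Base using (_⊎_; inj₁; inj₂; [_,_]′)
open import Data.Sum.Function.Propositional using (_⊎-↔_)
open import Data.Vec.Base using (Vec; []; _∷_; fromList; lookup; replicate; tabulate; toList)
open import Data.Vec.Properties
  using (cast-is-id; lookup∘tabulate; lookup⇒[]=; []=⇒lookup; tabulate-cong; tabulate∘lookup;
         toList-injective; toList∘fromList)
  renaming (∷-injectiveʳ to ∷ᵥ-injectiveʳ)
open import Function.Base using (_∘_)
open import Function.Bundles using (_↔_; _⇔_; mk⇔; mk↔ₛ′; module Equivalence; module Inverse)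
open import Function.Properties.Equivalence using () renaming (trans to ⇔-trans)
open import Function.Properties.Inverse using (↔-sym; ↔-trans)
open import Relation.Binary.Construct.Closure.Symmetric using (fwd; bwd)
open import Relation.Binary.PropositionalEquality
open import Relation.Nullary using (¬_; Dec; yes; no; does; contradiction)
open import Relation.Nullary.Decidable using (_×-dec_; dec-true; decidable-stable; map′; recompute)

open Equivalence using (to; from)

private
  variable
    N p m : ℕ

-- Adjacency in the hypercube

-- An inductive form of the adjacency of `Q m`, suited to recursion on the coordinates.
data CubeEdge : ∀ {m} → Vec (Fin 2) m → Vec (Fin 2) m → Set where
  here  : ∀ {m a b} {v : Vec (Fin 2) m} → a ≢ b → CubeEdge (a ∷ v) (b ∷ v)
  there : ∀ {m a} {u v : Vec (Fin 2) m} → CubeEdge u v → CubeEdge (a ∷ u) (a ∷ v)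

CubeEdge⇒∃! : ∀ {m} {u v : Vec (Fin 2) m} → CubeEdge u v → ∃! _≡_ λ i → lookup u i ≢ lookup v i
CubeEdge⇒∃! (here a≢b) =
  zero , a≢b , λ { {zero} _ → refl ; {suc _} v≢v → contradiction refl v≢v }
CubeEdge⇒∃! (there e) with i , u≢v , unique ← CubeEdge⇒∃! e =
  suc i , u≢v , λ { {zero} a≢a → contradiction refl a≢a ; {suc _} u≢v′ → cong suc (unique u≢v′) }

lookup-ext : ∀ {m} {u v : Vec (Fin 2) m} → (∀ i → lookup u i ≡ lookup v i) → u ≡ v
lookup-ext {u = u} {v} eq =
  trans (sym (tabulate∘lookup u)) (trans (tabulate-cong eq) (tabulate∘lookup v))

∃!⇒CubeEdge : ∀ {m} (u v : Vec (Fin 2) m) → (∃! _≡_ λ i → lookup u i ≢ lookup v i) → CubeEdge u v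
∃!⇒CubeEdge (a ∷ u) (b ∷ v) (zero , a≢b , unique) =
  subst (λ w → CubeEdge (a ∷ u) (b ∷ w))
        (lookup-ext λ i → decidable-stable (lookup u i Finₚ.≟ lookup v i)
                            λ u≢v → contradiction (unique {suc i} u≢v) λ ())
        (here a≢b)
∃!⇒CubeEdge (a ∷ u) (b ∷ v) (suc i , u≢v , unique) with a Finₚ.≟ b
... | yes refl = there (∃!⇒CubeEdge u v (i , u≢v , λ u≢v′ → Finₚ.suc-injective (unique u≢v′)))
... | no  a≢b  = contradiction (unique {zero} a≢b) λ ()

-- The hypercube is connected: coordinates are changed one at a time. This will make the label of
-- the edges in one direction of a cube constant.
locally-constant⇒constant : ∀ {A : Set} {m} (g : Vec (Fin 2) m → A) →
  (∀ {u v} → CubeEdge u v → g u ≡ g v) → ∀ u v → g u ≡ g v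
locally-constant⇒constant g const [] [] = refl
locally-constant⇒constant g const (a ∷ u) (b ∷ v) =
  trans (locally-constant⇒constant (λ w → g (a ∷ w)) (λ e → const (there e)) u v) flip
  where
  flip : g (a ∷ v) ≡ g (b ∷ v)
  flip with a Finₚ.≟ b
  ... | yes refl = refl
  ... | no  a≢b  = const (here a≢b)

-- Adjacent transpositions of binary words

Word : Set
Word = List Bool

data Direction : Set where
  ↑ ↓ : Direction

infix 4 _⟨_,_⟩_
-- A step carries its place and its direction because this pair is what parallel edges of a cube
-- share. `↑` is the direction that increases a prefix count.
data _⟨_,_⟩_ : Word → ℕ → Direction → Word → Set where
  up   : ∀ {w} → (false ∷ true ∷ w) ⟨ 0 , ↑ ⟩ (true ∷ false ∷ w)
  down : ∀ {w} → (true ∷ false ∷ w) ⟨ 0 , ↓ ⟩ (false ∷ true ∷ w)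
  skip : ∀ {b i σ u v} → u ⟨ i , σ ⟩ v → (b ∷ u) ⟨ suc i , σ ⟩ (b ∷ v)

WordEdge : Word → Word → Set
WordEdge u v = ∃₂ λ i σ → u ⟨ i , σ ⟩ v

opposite : Direction → Direction
opposite ↑ = ↓
opposite ↓ = ↑

reverse : ∀ {u v i σ} → u ⟨ i , σ ⟩ v → v ⟨ i , opposite σ ⟩ u
reverse up       = down
reverse down     = up
reverse (skip s) = skip (reverse s)

functional : ∀ {u v w i σ} → u ⟨ i , σ ⟩ v → u ⟨ i , σ ⟩ w → v ≡ w
functional up       up       = refl
functional down     down     = refl
functional (skip s) (skip t) = cong (_ ∷_) (functional s t)

bit : Bool → ℤ
bit false = 0ℤ
bit true  = 1ℤ

-- The number of letters true among the first j + 1 letters. In these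
-- coordinates a transposition is a unit step of the grid ℤ^s.
height : Word → ℕ → ℤ
height []      _       = 0ℤ
height (b ∷ w) zero    = bit b
height (b ∷ w) (suc j) = bit b + height w j

-- The displacement of a step in the grid, kept in `Maybe Direction` so that each entry has only
-- three possible values to check.
change : ℕ → Direction → ℕ → Maybe Direction
change zero    σ zero    = just σ
change (suc i) σ (suc j) = change i σ j
change _       _ _       = nothing

step : Maybe Direction → ℤ
step (just ↑) = 1ℤ
step (just ↓) = -1ℤ
step nothing  = 0ℤ

-- Exchanging the letters `i` and `i + 1` affects only the prefix that ends between them; longer
-- prefixes contain both letters.
height-step : ∀ {u v i σ} → u ⟨ i , σ ⟩ v → ∀ j →
              height v j ≡ height u j + step (change i σ j)
height-step up       zero          = refl
height-step up       (suc zero)    = refl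
height-step (up {w}) (suc (suc j)) = lemma (height w j)
  where
  lemma : ∀ x → 1ℤ + (0ℤ + x) ≡ 0ℤ + (1ℤ + x) + 0ℤ
  lemma = ℤ-Solver.solve-∀
height-step down       zero          = refl
height-step down       (suc zero)    = refl
height-step (down {w}) (suc (suc j)) = lemma (height w j)
  where
  lemma : ∀ x → 0ℤ + (1ℤ + x) ≡ 1ℤ + (0ℤ + x) + 0ℤ
  lemma = ℤ-Solver.solve-∀
height-step (skip {b} s) zero    = sym (ℤₚ.+-identityʳ (bit b))
height-step (skip {b} s) (suc j) =
  trans (cong (λ x → bit b + x) (height-step s j)) (sym (ℤₚ.+-assoc (bit b) _ _))

change-diag : ∀ i σ → change i σ i ≡ just σ
change-diag zero    σ = refl
change-diag (suc i) σ = change-diag i σ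

change-just : ∀ i j {σ τ} → change i σ j ≡ just τ → (i , σ) ≡ (j , τ)
change-just zero    zero    refl = refl
change-just (suc i) (suc j) eq   with refl ← change-just i j eq = refl

-- For `σ = ↑`, `step b` is not -1, so the left side is at least 1; `step c` is at most 0, so
-- `step d` must be 1. The case `↓` is symmetric.
parallelogram : ∀ σ b c d → step (just σ) + step b ≡ step c + step d →
                b ≢ just (opposite σ) → c ≢ just σ → d ≡ just σ
parallelogram ↑ _        _        (just ↑) _ _ _ = refl
parallelogram ↓ _        _        (just ↓) _ _ _ = refl
parallelogram ↑ (just ↓) _        _        _ b≢ _ = contradiction refl b≢
parallelogram ↓ (just ↑) _        _        _ b≢ _ = contradiction refl b≢
parallelogram ↑ _        (just ↑) _        _ _ c≢ = contradiction refl c≢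
parallelogram ↓ _        (just ↓) _        _ _ c≢ = contradiction refl c≢
parallelogram ↑ (just ↑) (just ↓) (just ↓) ()
parallelogram ↑ (just ↑) (just ↓) nothing  ()
parallelogram ↑ (just ↑) nothing  (just ↓) ()
parallelogram ↑ (just ↑) nothing  nothing  ()
parallelogram ↑ nothing  (just ↓) (just ↓) ()
parallelogram ↑ nothing  (just ↓) nothing  ()
parallelogram ↑ nothing  nothing  (just ↓) ()
parallelogram ↑ nothing  nothing  nothing  ()
parallelogram ↓ (just ↓) (just ↑) (just ↑) ()
parallelogram ↓ (just ↓) (just ↑) nothing  ()
parallelogram ↓ (just ↓) nothing  (just ↑) ()
parallelogram ↓ (just ↓) nothing  nothing  ()
parallelogram ↓ nothing  (just ↑) (just ↑) ()
parallelogram ↓ nothing  (just ↑) nothing  ()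
parallelogram ↓ nothing  nothing  (just ↑) ()
parallelogram ↓ nothing  nothing  nothing  ()

-- Compare, in coordinate i₁, the two paths from u to c.
opposite-edges-parallel : ∀ {u a b c i₁ σ₁ i₂ σ₂ i₃ σ₃ i₄ σ₄} →
  u ⟨ i₁ , σ₁ ⟩ a → a ⟨ i₂ , σ₂ ⟩ c → u ⟨ i₃ , σ₃ ⟩ b → b ⟨ i₄ , σ₄ ⟩ c →
  u ≢ c → a ≢ b → (i₁ , σ₁) ≡ (i₄ , σ₄)
opposite-edges-parallel {u} {a} {b} {c} {i₁} {σ₁} {i₂} {σ₂} {i₃} {σ₃} {i₄} {σ₄} ua ac ub bc u≢c a≢b =
  sym (change-just i₄ i₁ (parallelogram σ₁ _ _ _ sums no-return no-coincidence))
  where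
  open ≡-Reasoning
  open Groupₚ (AbelianGroup.group ℤₚ.+-0-abelianGroup) using () renaming (∙-cancelˡ to +-cancelˡ)

  sums : step (just σ₁) + step (change i₂ σ₂ i₁) ≡ step (change i₃ σ₃ i₁) + step (change i₄ σ₄ i₁)
  sums = +-cancelˡ (height u i₁) _ _ (begin
    height u i₁ + (step (just σ₁) + step (change i₂ σ₂ i₁))
      ≡⟨ ℤₚ.+-assoc (height u i₁) _ _ ⟨
    height u i₁ + step (just σ₁) + step (change i₂ σ₂ i₁)
      ≡⟨ cong (λ x → height u i₁ + step x + step (change i₂ σ₂ i₁)) (change-diag i₁ σ₁) ⟨
    height u i₁ + step (change i₁ σ₁ i₁) + step (change i₂ σ₂ i₁)
      ≡⟨ cong (λ x → x + step (change i₂ σ₂ i₁)) (height-step ua i₁) ⟨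
    height a i₁ + step (change i₂ σ₂ i₁)
      ≡⟨ height-step ac i₁ ⟨
    height c i₁
      ≡⟨ height-step bc i₁ ⟩
    height b i₁ + step (change i₄ σ₄ i₁)
      ≡⟨ cong (λ x → x + step (change i₄ σ₄ i₁)) (height-step ub i₁) ⟩
    height u i₁ + step (change i₃ σ₃ i₁) + step (change i₄ σ₄ i₁)
      ≡⟨ ℤₚ.+-assoc (height u i₁) _ _ ⟩
    height u i₁ + (step (change i₃ σ₃ i₁) + step (change i₄ σ₄ i₁)) ∎)

  -- Undoing the change of coordinate `i₁` would retrace the edge from `u` to `a`, and `c` would be
  -- `u`.
  no-return : change i₂ σ₂ i₁ ≢ just (opposite σ₁)
  no-return eq with refl ← change-just i₂ i₁ eq = u≢c (functional (reverse ua) ac)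

  no-coincidence : change i₃ σ₃ i₁ ≢ just σ₁
  no-coincidence eq with refl ← change-just i₃ i₁ eq = a≢b (functional ua ub)

-- Tilings of a word by the tiles 0, 1 and {01, 10}

-- N tiles, of which p are not z and m are x. The tile x stands for both
-- 01 and 10, so that a tiling stands for 2^m words of length N + m.
data Tiling : (N p m : ℕ) → Set where
  []  : Tiling 0 0 0
  z∷_ : ∀ {N p m} → Tiling N p m → Tiling (suc N) p m
  o∷_ : ∀ {N p m} → Tiling N p m → Tiling (suc N) (suc p) m
  x∷_ : ∀ {N p m} → Tiling N p m → Tiling (suc N) (suc p) (suc m)

infixr 5 z∷_ o∷_ x∷_

infix 4 _∈_ _∈?_
data _∈_ : ∀ {N p m} → Word → Tiling N p m → Set where
  []  : [] ∈ []
  z∷_ : ∀ {N p m w} {t : Tiling N p m} → w ∈ t → false ∷ w ∈ z∷ t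
  o∷_ : ∀ {N p m w} {t : Tiling N p m} → w ∈ t → true ∷ w ∈ o∷ t
  x₀∷_ : ∀ {N p m w} {t : Tiling N p m} → w ∈ t → false ∷ true ∷ w ∈ x∷ t
  x₁∷_ : ∀ {N p m w} {t : Tiling N p m} → w ∈ t → true ∷ false ∷ w ∈ x∷ t

_∈?_ : ∀ {N p m} w (t : Tiling N p m) → Dec (w ∈ t)
[]                  ∈? []     = yes []
(_ ∷ _)             ∈? []     = no λ ()
[]                  ∈? (z∷ t) = no λ ()
(false ∷ w)         ∈? (z∷ t) = map′ z∷_ (λ { (z∷ w∈t) → w∈t }) (w ∈? t)
(true ∷ w)          ∈? (z∷ t) = no λ ()
[]                  ∈? (o∷ t) = no λ ()
(false ∷ w)         ∈? (o∷ t) = no λ ()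
(true ∷ w)          ∈? (o∷ t) = map′ o∷_ (λ { (o∷ w∈t) → w∈t }) (w ∈? t)
[]                  ∈? (x∷ t) = no λ ()
(_ ∷ [])            ∈? (x∷ t) = no λ ()
(false ∷ false ∷ w) ∈? (x∷ t) = no λ ()
(false ∷ true ∷ w)  ∈? (x∷ t) = map′ x₀∷_ (λ { (x₀∷ w∈t) → w∈t }) (w ∈? t)
(true ∷ false ∷ w)  ∈? (x∷ t) = map′ x₁∷_ (λ { (x₁∷ w∈t) → w∈t }) (w ∈? t)
(true ∷ true ∷ w)   ∈? (x∷ t) = no λ ()

-- Each coordinate of the hypercube chooses between the readings 01 and 10 of one tile `x`.
word : ∀ {N p m} → Tiling N p m → Vec (Fin 2) m → Word
word []     []       = []
word (z∷ t) v        = false ∷ word t v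
word (o∷ t) v        = true ∷ word t v
word (x∷ t) (0F ∷ v) = false ∷ true ∷ word t v
word (x∷ t) (1F ∷ v) = true ∷ false ∷ word t v

word∈ : ∀ {N p m} (t : Tiling N p m) v → word t v ∈ t
word∈ []     []       = []
word∈ (z∷ t) v        = z∷ word∈ t v
word∈ (o∷ t) v        = o∷ word∈ t v
word∈ (x∷ t) (0F ∷ v) = x₀∷ word∈ t v
word∈ (x∷ t) (1F ∷ v) = x₁∷ word∈ t v

word-surjective : ∀ {N p m w} {t : Tiling N p m} → w ∈ t → ∃ λ v → word t v ≡ w
word-surjective []        = [] , refl
word-surjective (z∷ w∈t)  with v , refl ← word-surjective w∈t = v , refl
word-surjective (o∷ w∈t)  with v , refl ← word-surjective w∈t = v , refl
word-surjective (x₀∷ w∈t) with v , refl ← word-surjective w∈t = 0F ∷ v , refl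
word-surjective (x₁∷ w∈t) with v , refl ← word-surjective w∈t = 1F ∷ v , refl

word-injective : ∀ {N p m} (t : Tiling N p m) u v → word t u ≡ word t v → u ≡ v
word-injective []     []       []       _  = refl
word-injective (z∷ t) u        v        eq = word-injective t u v (∷-injectiveʳ eq)
word-injective (o∷ t) u        v        eq = word-injective t u v (∷-injectiveʳ eq)
word-injective (x∷ t) (0F ∷ u) (0F ∷ v) eq =
  cong (0F ∷_) (word-injective t u v (∷-injectiveʳ (∷-injectiveʳ eq)))
word-injective (x∷ t) (0F ∷ u) (1F ∷ v) ()
word-injective (x∷ t) (1F ∷ u) (0F ∷ v) ()
word-injective (x∷ t) (1F ∷ u) (1F ∷ v) eq =
  cong (1F ∷_) (word-injective t u v (∷-injectiveʳ (∷-injectiveʳ eq)))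

skip-edge : ∀ {b u v} → WordEdge u v → WordEdge (b ∷ u) (b ∷ v)
skip-edge (i , σ , s) = suc i , σ , skip s

word-edge : ∀ {N p m} (t : Tiling N p m) {u v} → CubeEdge u v → WordEdge (word t u) (word t v)
word-edge (z∷ t) e = skip-edge (word-edge t e)
word-edge (o∷ t) e = skip-edge (word-edge t e)
word-edge (x∷ t) {0F ∷ _} {0F ∷ _} (here 0≢0) = contradiction refl 0≢0
word-edge (x∷ t) {0F ∷ _} {1F ∷ _} (here _)   = 0 , ↑ , up
word-edge (x∷ t) {1F ∷ _} {0F ∷ _} (here _)   = 0 , ↓ , down
word-edge (x∷ t) {1F ∷ _} {1F ∷ _} (here 1≢1) = contradiction refl 1≢1
word-edge (x∷ t) {0F ∷ _} (there e) = skip-edge (skip-edge (word-edge t e))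
word-edge (x∷ t) {1F ∷ _} (there e) = skip-edge (skip-edge (word-edge t e))

-- At the first tile read differently the step must exchange the two letters of that tile, and it
-- fixes everything after. So the words of a tiling induce a hypercube without further edges.
word-edge⁻ : ∀ {N p m} (t : Tiling N p m) u v {i σ} → word t u ⟨ i , σ ⟩ word t v → CubeEdge u v
word-edge⁻ []     []       []       ()
word-edge⁻ (z∷ t) u        v        (skip s)        = word-edge⁻ t u v s
word-edge⁻ (o∷ t) u        v        (skip s)        = word-edge⁻ t u v s
word-edge⁻ (x∷ t) (0F ∷ u) (0F ∷ v) (skip (skip s)) = there (word-edge⁻ t u v s)
word-edge⁻ (x∷ t) (1F ∷ u) (1F ∷ v) (skip (skip s)) = there (word-edge⁻ t u v s)
-- Abstracting `word t u` lets `up` unify it with `word t v`; `eq` keeps the resulting equality for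
-- `word-injective`.
word-edge⁻ (x∷ t) (0F ∷ u) (1F ∷ v) s with word t u in eq
word-edge⁻ (x∷ t) (0F ∷ u) (1F ∷ v) up | _
  with refl ← word-injective t u v eq = here λ ()
word-edge⁻ (x∷ t) (1F ∷ u) (0F ∷ v) s with word t u in eq
word-edge⁻ (x∷ t) (1F ∷ u) (0F ∷ v) down | _
  with refl ← word-injective t u v eq = here λ ()

infix 4 _≐_
_≐_ : ∀ {N p m N′ p′ m′} → Tiling N p m → Tiling N′ p′ m′ → Set
t ≐ t′ = ∀ w → w ∈ t ⇔ w ∈ t′

inhabited : ∀ {N p m} (t : Tiling N p m) → ∃ (_∈ t)
inhabited {m = m} t = word t (replicate m 0F) , word∈ t _

-- The first letters of the words reveal the first tile: only `false` for `z`, only `true` for `o`,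
-- both for `x`. Hence distinct tilings will give distinct cubes.
≐⇒≡ : ∀ {N p m} (t t′ : Tiling N p m) → t ≐ t′ → t ≡ t′
≐⇒≡ []     []      _  = refl
≐⇒≡ (z∷ t) (z∷ t′) eq = cong z∷_ (≐⇒≡ t t′ λ w →
  mk⇔ (λ w∈ → case-z (to (eq _) (z∷ w∈))) (λ w∈ → case-z (from (eq _) (z∷ w∈))))
  where
  case-z : ∀ {N p m w} {t : Tiling N p m} → false ∷ w ∈ z∷ t → w ∈ t
  case-z (z∷ w∈) = w∈
≐⇒≡ (o∷ t) (o∷ t′) eq = cong o∷_ (≐⇒≡ t t′ λ w →
  mk⇔ (λ w∈ → case-o (to (eq _) (o∷ w∈))) (λ w∈ → case-o (from (eq _) (o∷ w∈))))
  where
  case-o : ∀ {N p m w} {t : Tiling N p m} → true ∷ w ∈ o∷ t → w ∈ t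
  case-o (o∷ w∈) = w∈
≐⇒≡ (x∷ t) (x∷ t′) eq = cong x∷_ (≐⇒≡ t t′ λ w →
  mk⇔ (λ w∈ → case-x (to (eq _) (x₀∷ w∈))) (λ w∈ → case-x (from (eq _) (x₀∷ w∈))))
  where
  case-x : ∀ {N p m w} {t : Tiling N p m} → false ∷ true ∷ w ∈ x∷ t → w ∈ t
  case-x (x₀∷ w∈) = w∈
≐⇒≡ (z∷ t) (o∷ t′) eq with _ , w∈ ← inhabited t with () ← to (eq _) (z∷ w∈)
≐⇒≡ (o∷ t) (z∷ t′) eq with _ , w∈ ← inhabited t with () ← to (eq _) (o∷ w∈)
≐⇒≡ (z∷ t) (x∷ t′) eq with _ , w∈ ← inhabited t′ with () ← from (eq _) (x₁∷ w∈)
≐⇒≡ (x∷ t) (z∷ t′) eq with _ , w∈ ← inhabited t with () ← to (eq _) (x₁∷ w∈)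
≐⇒≡ (o∷ t) (x∷ t′) eq with _ , w∈ ← inhabited t′ with () ← from (eq _) (x₀∷ w∈)
≐⇒≡ (x∷ t) (o∷ t′) eq with _ , w∈ ← inhabited t with () ← to (eq _) (x₀∷ w∈)

∈-length : ∀ {N p m w} {t : Tiling N p m} → w ∈ t → length w ≡ N ℕ.+ m
∈-length []       = refl
∈-length (z∷ w∈)  = cong suc (∈-length w∈)
∈-length (o∷ w∈)  = cong suc (∈-length w∈)
∈-length {suc N} {m = suc m} (x₀∷ w∈) = cong suc (trans (cong suc (∈-length w∈)) (sym (ℕₚ.+-suc N m)))
∈-length {suc N} {m = suc m} (x₁∷ w∈) = cong suc (trans (cong suc (∈-length w∈)) (sym (ℕₚ.+-suc N m)))

trues : Word → ℕ
trues []          = 0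
trues (false ∷ w) = trues w
trues (true ∷ w)  = suc (trues w)

∈-trues : ∀ {N p m w} {t : Tiling N p m} → w ∈ t → trues w ≡ p
∈-trues []       = refl
∈-trues (z∷ w∈)  = ∈-trues w∈
∈-trues (o∷ w∈)  = cong suc (∈-trues w∈)
∈-trues (x₀∷ w∈) = cong suc (∈-trues w∈)
∈-trues (x₁∷ w∈) = cong suc (∈-trues w∈)

-- Two opposite faces of a cube: the words of `t`, and those reached from them by one fixed
-- transposition.
Swept : Tiling N p m → ℕ → Direction → Word → Set
Swept t i σ w = w ∈ t ⊎ ∃ λ u → u ∈ t × u ⟨ i , σ ⟩ w

Movable : Tiling N p m → ℕ → Direction → Set
Movable t i σ = ∀ {w} → w ∈ t → ∃ λ w′ → w ⟨ i , σ ⟩ w′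

z∷-swept : ∀ {t : Tiling N p m} {i σ w} → Swept t i σ w → Swept (z∷ t) (suc i) σ (false ∷ w)
z∷-swept (inj₁ w∈)           = inj₁ (z∷ w∈)
z∷-swept (inj₂ (_ , u∈ , s)) = inj₂ (_ , z∷ u∈ , skip s)

o∷-swept : ∀ {t : Tiling N p m} {i σ w} → Swept t i σ w → Swept (o∷ t) (suc i) σ (true ∷ w)
o∷-swept (inj₁ w∈)           = inj₁ (o∷ w∈)
o∷-swept (inj₂ (_ , u∈ , s)) = inj₂ (_ , o∷ u∈ , skip s)

x₀∷-swept : ∀ {t : Tiling N p m} {i σ w} → Swept t i σ w → Swept (x∷ t) (2 ℕ.+ i) σ (false ∷ true ∷ w)
x₀∷-swept (inj₁ w∈)           = inj₁ (x₀∷ w∈)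
x₀∷-swept (inj₂ (_ , u∈ , s)) = inj₂ (_ , x₀∷ u∈ , skip (skip s))

x₁∷-swept : ∀ {t : Tiling N p m} {i σ w} → Swept t i σ w → Swept (x∷ t) (2 ℕ.+ i) σ (true ∷ false ∷ w)
x₁∷-swept (inj₁ w∈)           = inj₁ (x₁∷ w∈)
x₁∷-swept (inj₂ (_ , u∈ , s)) = inj₂ (_ , x₁∷ u∈ , skip (skip s))

unskip : ∀ {b w i σ} → (∃ λ w′ → b ∷ w ⟨ suc i , σ ⟩ w′) → ∃ λ w′ → w ⟨ i , σ ⟩ w′
unskip (_ , skip s) = _ , s

-- A transposition that applies to every word of a tiling acts on two
-- neighbouring tiles z and o, which the swept tiling replaces by a tile x.
sweep : (t : Tiling N p m) (i : ℕ) (σ : Direction) → Movable t i σ →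
        ∃ λ N′ → Σ (Tiling N′ p (suc m)) λ t′ → ∀ w → w ∈ t′ ⇔ Swept t i σ w
sweep [] i σ move with () ← proj₂ (move [])
sweep (z∷ []) zero ↑ move with () ← proj₂ (move (z∷ []))
sweep (z∷ z∷ t) zero ↑ move with _ , w∈ ← inhabited t with () ← proj₂ (move (z∷ z∷ w∈))
sweep (z∷ o∷ t) zero ↑ move = _ , x∷ t , λ w → mk⇔
  (λ { (x₀∷ w∈) → inj₁ (z∷ o∷ w∈) ; (x₁∷ w∈) → inj₂ (_ , z∷ o∷ w∈ , up) })
  (λ { (inj₁ (z∷ o∷ w∈)) → x₀∷ w∈ ; (inj₂ (_ , z∷ o∷ w∈ , up)) → x₁∷ w∈ })
sweep (z∷ x∷ t) zero ↑ move with _ , w∈ ← inhabited t with () ← proj₂ (move (z∷ x₀∷ w∈))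
sweep (z∷ t) zero ↓ move with _ , w∈ ← inhabited t with () ← proj₂ (move (z∷ w∈))
sweep (z∷ t) (suc i) σ move
  with _ , t′ , eq ← sweep t i σ (λ w∈ → unskip (move (z∷ w∈)))
  = _ , z∷ t′ , λ w → mk⇔
  (λ { (z∷ w∈) → z∷-swept (to (eq _) w∈) })
  (λ { (inj₁ (z∷ w∈)) → z∷ from (eq _) (inj₁ w∈)
     ; (inj₂ (_ , z∷ u∈ , skip s)) → z∷ from (eq _) (inj₂ (_ , u∈ , s)) })
sweep (o∷ []) zero ↓ move with () ← proj₂ (move (o∷ []))
sweep (o∷ z∷ t) zero ↓ move = _ , x∷ t , λ w → mk⇔
  (λ { (x₁∷ w∈) → inj₁ (o∷ z∷ w∈) ; (x₀∷ w∈) → inj₂ (_ , o∷ z∷ w∈ , down) })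
  (λ { (inj₁ (o∷ z∷ w∈)) → x₁∷ w∈ ; (inj₂ (_ , o∷ z∷ w∈ , down)) → x₀∷ w∈ })
sweep (o∷ o∷ t) zero ↓ move with _ , w∈ ← inhabited t with () ← proj₂ (move (o∷ o∷ w∈))
sweep (o∷ x∷ t) zero ↓ move with _ , w∈ ← inhabited t with () ← proj₂ (move (o∷ x₁∷ w∈))
sweep (o∷ t) zero ↑ move with _ , w∈ ← inhabited t with () ← proj₂ (move (o∷ w∈))
sweep (o∷ t) (suc i) σ move
  with _ , t′ , eq ← sweep t i σ (λ w∈ → unskip (move (o∷ w∈)))
  = _ , o∷ t′ , λ w → mk⇔
  (λ { (o∷ w∈) → o∷-swept (to (eq _) w∈) })
  (λ { (inj₁ (o∷ w∈)) → o∷ from (eq _) (inj₁ w∈)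
     ; (inj₂ (_ , o∷ u∈ , skip s)) → o∷ from (eq _) (inj₂ (_ , u∈ , s)) })
-- A transposition that starts at either letter of a tile `x` is blocked in one of the two readings
-- of the tile.
sweep (x∷ t) zero ↑ move with _ , w∈ ← inhabited t with () ← proj₂ (move (x₁∷ w∈))
sweep (x∷ t) zero ↓ move with _ , w∈ ← inhabited t with () ← proj₂ (move (x₀∷ w∈))
sweep (x∷ t) (suc zero) ↑ move with _ , w∈ ← inhabited t with _ , skip () ← move (x₀∷ w∈)
sweep (x∷ t) (suc zero) ↓ move with _ , w∈ ← inhabited t with _ , skip () ← move (x₁∷ w∈)
sweep (x∷ t) (suc (suc i)) σ move
  with _ , t′ , eq ← sweep t i σ (λ w∈ → unskip (unskip (move (x₀∷ w∈))))
  = _ , x∷ t′ , λ w → mk⇔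
  (λ { (x₀∷ w∈) → x₀∷-swept (to (eq _) w∈) ; (x₁∷ w∈) → x₁∷-swept (to (eq _) w∈) })
  (λ { (inj₁ (x₀∷ w∈)) → x₀∷ from (eq _) (inj₁ w∈)
     ; (inj₁ (x₁∷ w∈)) → x₁∷ from (eq _) (inj₁ w∈)
     ; (inj₂ (_ , x₀∷ u∈ , skip (skip s))) → x₀∷ from (eq _) (inj₂ (_ , u∈ , s))
     ; (inj₂ (_ , x₁∷ u∈ , skip (skip s))) → x₁∷ from (eq _) (inj₂ (_ , u∈ , s)) })

-- From cubes of words to tilings

singleton : (w : Word) → Tiling (length w) (trues w) 0
singleton []          = []
singleton (false ∷ w) = z∷ singleton w
singleton (true ∷ w)  = o∷ singleton w

∈-singleton⁺ : ∀ w → w ∈ singleton w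
∈-singleton⁺ []          = []
∈-singleton⁺ (false ∷ w) = z∷ ∈-singleton⁺ w
∈-singleton⁺ (true ∷ w)  = o∷ ∈-singleton⁺ w

∈-singleton⁻ : ∀ {u} w → u ∈ singleton w → w ≡ u
∈-singleton⁻ []          []      = refl
∈-singleton⁻ (false ∷ w) (z∷ u∈) = cong (false ∷_) (∈-singleton⁻ w u∈)
∈-singleton⁻ (true ∷ w)  (o∷ u∈) = cong (true ∷_) (∈-singleton⁻ w u∈)

-- The face `0F` is a tiling by induction. All edges from it to the face `1F` are parallel, so one
-- transposition carries the first face to the second, and `sweep` applies.
cube⇒tiling : (f : Vec (Fin 2) m → Word) →
  (∀ {u v} → CubeEdge u v → WordEdge (f u) (f v)) →
  (∀ {u v} → f u ≡ f v → u ≡ v) →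
  ∃₂ λ N p → Σ (Tiling N p m) λ t → ∀ w → w ∈ t ⇔ ∃ λ v → f v ≡ w
cube⇒tiling {zero} f edge injective = _ , _ , singleton (f []) , λ w → mk⇔
  (λ w∈ → [] , ∈-singleton⁻ (f []) w∈)
  (λ { ([] , refl) → ∈-singleton⁺ (f []) })
cube⇒tiling {suc m} f edge injective
  with N , p , t , eq ← cube⇒tiling (f ∘ (0F ∷_)) (edge ∘ there) (∷ᵥ-injectiveʳ ∘ injective)
  = extend
  where
  across : ∀ v → WordEdge (f (0F ∷ v)) (f (1F ∷ v))
  across v = edge (here λ ())

  label : Vec (Fin 2) m → ℕ × Direction
  label v = let i , σ , _ = across v in i , σ

  label-edge : ∀ {u v} → CubeEdge u v → label u ≡ label v
  -- The 4-cycle is `f (0F ∷ u)`, `f (1F ∷ u)`, `f (1F ∷ v)`, `f (0F ∷ v)`; injectivity separates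
  -- its opposite corners.
  label-edge {u} {v} e = opposite-edges-parallel
    (proj₂ (proj₂ (across u))) (proj₂ (proj₂ (edge (there e))))
    (proj₂ (proj₂ (edge (there e)))) (proj₂ (proj₂ (across v)))
    ((λ ()) ∘ injective) ((λ ()) ∘ injective)

  -- The zero vector is an arbitrary base point, since the label is constant.
  i₀ : ℕ
  i₀ = proj₁ (label (replicate m 0F))

  σ₀ : Direction
  σ₀ = proj₂ (label (replicate m 0F))

  parallel : ∀ v → f (0F ∷ v) ⟨ i₀ , σ₀ ⟩ f (1F ∷ v)
  parallel v = subst (λ (i , σ) → f (0F ∷ v) ⟨ i , σ ⟩ f (1F ∷ v))
    (locally-constant⇒constant label label-edge v (replicate m 0F)) (proj₂ (proj₂ (across v)))

  movable : Movable t i₀ σ₀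
  movable w∈ with v , refl ← to (eq _) w∈ = _ , parallel v

  extend : ∃₂ λ N p → Σ (Tiling N p (suc m)) λ t → ∀ w → w ∈ t ⇔ ∃ λ v → f v ≡ w
  extend with N′ , t′ , eq′ ← sweep t i₀ σ₀ movable =
    N′ , p , t′ , λ w → ⇔-trans (eq′ w) (mk⇔ image preimage)
    where
    image : ∀ {w} → Swept t i₀ σ₀ w → ∃ λ v → f v ≡ w
    image (inj₁ w∈) with v , refl ← to (eq _) w∈ = 0F ∷ v , refl
    image (inj₂ (u , u∈ , s)) with v , refl ← to (eq _) u∈ = 1F ∷ v , functional (parallel v) s

    preimage : ∀ {w} → (∃ λ v → f v ≡ w) → Swept t i₀ σ₀ w
    preimage (0F ∷ v , refl) = inj₁ (from (eq _) (v , refl))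
    preimage (1F ∷ v , refl) = inj₂ (_ , from (eq _) (v , refl) , parallel v)

-- Counting tilings

-- The clauses distinguish the first tile: `p = 0` leaves only `z`, and `m = 0` excludes `x`.
tilingCount : ℕ → ℕ → ℕ → ℕ
tilingCount zero    zero    zero    = 1
tilingCount zero    zero    (suc m) = 0
tilingCount zero    (suc p) m       = 0
tilingCount (suc N) zero    m       = tilingCount N zero m
tilingCount (suc N) (suc p) zero    = tilingCount N (suc p) zero ℕ.+ tilingCount N p zero
tilingCount (suc N) (suc p) (suc m) =
  tilingCount N (suc p) (suc m) ℕ.+ (tilingCount N p (suc m) ℕ.+ tilingCount N p m)

tilings : ∀ N p m → Fin (tilingCount N p m) ↔ Tiling N p m
tilings zero zero zero =
  mk↔ₛ′ (λ _ → []) (λ _ → zero) (λ { [] → refl }) (λ { zero → refl })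
tilings zero zero    (suc m) = mk↔ₛ′ (λ ()) (λ ()) (λ ()) (λ ())
tilings zero (suc p) m       = mk↔ₛ′ (λ ()) (λ ()) (λ ()) (λ ())
tilings (suc N) zero m = ↔-trans (tilings N zero m)
  (mk↔ₛ′ z∷_ (λ { (z∷ t) → t }) (λ { (z∷ t) → refl }) (λ _ → refl))
tilings (suc N) (suc p) zero =
  ↔-trans Finₚ.+↔⊎ (↔-trans (tilings N (suc p) zero ⊎-↔ tilings N p zero)
    (mk↔ₛ′ (λ { (inj₁ t) → z∷ t ; (inj₂ t) → o∷ t })
           (λ { (z∷ t) → inj₁ t ; (o∷ t) → inj₂ t })
           (λ { (z∷ t) → refl ; (o∷ t) → refl })
           (λ { (inj₁ t) → refl ; (inj₂ t) → refl })))
tilings (suc N) (suc p) (suc m) =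
  ↔-trans Finₚ.+↔⊎ (↔-trans
    (tilings N (suc p) (suc m) ⊎-↔ ↔-trans Finₚ.+↔⊎ (tilings N p (suc m) ⊎-↔ tilings N p m))
    (mk↔ₛ′ (λ { (inj₁ t) → z∷ t ; (inj₂ (inj₁ t)) → o∷ t ; (inj₂ (inj₂ t)) → x∷ t })
           (λ { (z∷ t) → inj₁ t ; (o∷ t) → inj₂ (inj₁ t) ; (x∷ t) → inj₂ (inj₂ t) })
           (λ { (z∷ t) → refl ; (o∷ t) → refl ; (x∷ t) → refl })
           (λ { (inj₁ t) → refl ; (inj₂ (inj₁ t)) → refl ; (inj₂ (inj₂ t)) → refl })))

nC0≡1 : ∀ n → n C 0 ≡ 1
nC0≡1 zero    = refl
nC0≡1 (suc n) = refl

-- Pascal's rule for `p` and `m` merges the tilings that begin with `o` or `x`; Pascal's rule for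
-- `N` and `p` then adds those that begin with `z`.
tilingCount≡ : ∀ N p m → tilingCount N p m ≡ (N C p) ℕ.* (p C m)
tilingCount≡ zero zero    zero    = refl
tilingCount≡ zero zero    (suc m) = refl
tilingCount≡ zero (suc p) m       = refl
tilingCount≡ (suc N) zero m = trans (tilingCount≡ N zero m) (cong (ℕ._* (0 C m)) (nC0≡1 N))
tilingCount≡ (suc N) (suc p) zero = begin
  tilingCount N (suc p) 0 ℕ.+ tilingCount N p 0
    ≡⟨ cong₂ ℕ._+_ (tilingCount≡ N (suc p) 0) (tilingCount≡ N p 0) ⟩
  (N C suc p) ℕ.* 1 ℕ.+ (N C p) ℕ.* (p C 0)
    ≡⟨ cong (λ c → (N C suc p) ℕ.* 1 ℕ.+ (N C p) ℕ.* c) (nC0≡1 p) ⟩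
  (N C suc p) ℕ.* 1 ℕ.+ (N C p) ℕ.* 1
    ≡⟨ lemma (N C p) (N C suc p) ⟩
  ((N C p) ℕ.+ (N C suc p)) ℕ.* 1
    ≡⟨ cong (ℕ._* 1) (nCk+nC[k+1]≡[n+1]C[k+1] N p) ⟩
  (suc N C suc p) ℕ.* 1 ∎
  where
  open ≡-Reasoning
  lemma : ∀ a b → b ℕ.* 1 ℕ.+ a ℕ.* 1 ≡ (a ℕ.+ b) ℕ.* 1
  lemma = ℕ-Solver.solve-∀
tilingCount≡ (suc N) (suc p) (suc m) = begin
  tilingCount N (suc p) (suc m) ℕ.+ (tilingCount N p (suc m) ℕ.+ tilingCount N p m)
    ≡⟨ cong₂ ℕ._+_ (tilingCount≡ N (suc p) (suc m)) (cong₂ ℕ._+_ (tilingCount≡ N p (suc m)) (tilingCount≡ N p m)) ⟩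
  (N C suc p) ℕ.* (suc p C suc m) ℕ.+ ((N C p) ℕ.* (p C suc m) ℕ.+ (N C p) ℕ.* (p C m))
    ≡⟨ lemma (N C p) (N C suc p) (suc p C suc m) (p C m) (p C suc m) ⟩
  (N C suc p) ℕ.* (suc p C suc m) ℕ.+ (N C p) ℕ.* ((p C m) ℕ.+ (p C suc m))
    ≡⟨ cong (λ c → (N C suc p) ℕ.* (suc p C suc m) ℕ.+ (N C p) ℕ.* c) (nCk+nC[k+1]≡[n+1]C[k+1] p m) ⟩
  (N C suc p) ℕ.* (suc p C suc m) ℕ.+ (N C p) ℕ.* (suc p C suc m)
    ≡⟨ lemma′ (N C p) (N C suc p) (suc p C suc m) ⟩
  ((N C p) ℕ.+ (N C suc p)) ℕ.* (suc p C suc m)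
    ≡⟨ cong (ℕ._* (suc p C suc m)) (nCk+nC[k+1]≡[n+1]C[k+1] N p) ⟩
  (suc N C suc p) ℕ.* (suc p C suc m) ∎
  where
  open ≡-Reasoning
  lemma : ∀ a b c d e → b ℕ.* c ℕ.+ (a ℕ.* e ℕ.+ a ℕ.* d) ≡ b ℕ.* c ℕ.+ a ℕ.* (d ℕ.+ e)
  lemma = ℕ-Solver.solve-∀
  lemma′ : ∀ a b c → b ℕ.* c ℕ.+ a ℕ.* c ≡ (a ℕ.+ b) ℕ.* c
  lemma′ = ℕ-Solver.solve-∀

-- Cubes in graphs of words

-- An isomorphism from `G` to the graph of words of length `s` with `p` letters `true`; `decode` is
-- its surjectivity. Counting cubes needs only this interface.
record WordModel (G : Graph) (s p : ℕ) : Set where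
  open Graph G
  field
    encode           : Vertex → Word
    encode-injective : ∀ {u v} → encode u ≡ encode v → u ≡ v
    encode-length    : ∀ v → length (encode v) ≡ s
    encode-trues     : ∀ v → trues (encode v) ≡ p
    decode           : ∀ w → length w ≡ s → trues w ≡ p → ∃ λ v → encode v ≡ w
    encode-edge      : ∀ u v → u ~ v ⇔ WordEdge (encode u) (encode v)

module CubeCount {G : Graph} {s p : ℕ} (M : WordModel G s p) where
  open WordModel M
  open Graph G
  open Finite vertices using (element; position; element-position; position-element)

  cells : ∀ {N m} → Tiling N p m → Subset order
  cells t = tabulate λ i → does (encode (element i) ∈? t)

  ∈-cells : ∀ {N m} (t : Tiling N p m) i → i ∈ₛ cells t ⇔ encode (element i) ∈ t
  ∈-cells t i = mk⇔
    (λ i∈ → witness (trans (sym (lookup∘tabulate _ i)) ([]=⇒lookup i∈)))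
    (λ w∈ → lookup⇒[]= i _ (trans (lookup∘tabulate _ i) (dec-true (encode (element i) ∈? t) w∈)))
    where
    witness : does (encode (element i) ∈? t) ≡ true → encode (element i) ∈ t
    witness eq with yes w∈ ← encode (element i) ∈? t = w∈

  position∈-cells : ∀ {N m} (t : Tiling N p m) v → position v ∈ₛ cells t ⇔ encode v ∈ t
  position∈-cells t v =
    subst (λ v′ → position v ∈ₛ cells t ⇔ encode v′ ∈ t) (element-position v) (∈-cells t (position v))

  decode∈ : ∀ {N m w} {t : Tiling N p m} → N ℕ.+ m ≡ s → w ∈ t → ∃ λ v → encode v ≡ w
  decode∈ N+m≡s w∈ = decode _ (trans (∈-length w∈) N+m≡s) (∈-trues w∈)

  -- By `N + m ≡ s` every word of either tiling encodes a vertex, so the vertex set determines the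
  -- set of words and `≐⇒≡` applies.
  cells-injective : ∀ {N m} (t t′ : Tiling N p m) → N ℕ.+ m ≡ s → cells t ≡ cells t′ → t ≡ t′
  cells-injective {N} {m} t t′ N+m≡s eq = ≐⇒≡ t t′ λ w → mk⇔ (transfer eq) (transfer (sym eq))
    where
    transfer : ∀ {t t′ : Tiling N p m} {w} → cells t ≡ cells t′ → w ∈ t → w ∈ t′
    transfer {t} {t′} eq w∈ with v , refl ← decode∈ N+m≡s w∈ =
      to (position∈-cells t′ v) (subst (position v ∈ₛ_) eq (from (position∈-cells t v) w∈))

  -- The isomorphism is the inverse of `word t`, followed by decoding in the other direction;
  -- `word-edge` and `word-edge⁻` match the edges.
  cells≅Q : ∀ {N m} (t : Tiling N p m) → N ℕ.+ m ≡ s → induced G (cells t) ≅ Q m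
  cells≅Q {m = m} t N+m≡s = record
    { bijection = mk↔ₛ′ coordinates vertex coordinates-vertex vertex-coordinates
    ; adjacency = λ a b → ⇔-trans (encode-edge (value a) (value b))
        (subst₂ (λ w w′ → WordEdge w w′ ⇔ (∃! _≡_ λ i → lookup (coordinates a) i ≢ lookup (coordinates b) i))
          (word-coordinates a) (word-coordinates b)
          (mk⇔ (λ (_ , _ , e) → CubeEdge⇒∃! (word-edge⁻ t _ _ e))
               (λ e → word-edge t (∃!⇒CubeEdge _ _ e))))
    }
    where
    Cell : Set
    Cell = Graph.Vertex (induced G (cells t))

    encode∈ : (a : Cell) → encode (value a) ∈ t
    encode∈ (v , [ v∈ ]) = to (position∈-cells t v) (recompute (position v ∈ₛ? cells t) v∈)

    coordinates : Cell → Vec (Fin 2) m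
    coordinates a = proj₁ (word-surjective (encode∈ a))

    word-coordinates : ∀ a → word t (coordinates a) ≡ encode (value a)
    word-coordinates a = proj₂ (word-surjective (encode∈ a))

    vertexOf : ∀ u → ∃ λ v → encode v ≡ word t u
    vertexOf u = decode∈ N+m≡s (word∈ t u)

    vertex : Vec (Fin 2) m → Cell
    vertex u = let v , eq = vertexOf u in
      v , [ from (position∈-cells t v) (subst (_∈ t) (sym eq) (word∈ t u)) ]

    coordinates-vertex : ∀ u → coordinates (vertex u) ≡ u
    coordinates-vertex u =
      word-injective t _ _ (trans (word-coordinates (vertex u)) (proj₂ (vertexOf u)))

    vertex-coordinates : ∀ a → vertex (coordinates a) ≡ a
    vertex-coordinates a = value-injective
      (encode-injective (trans (proj₂ (vertexOf (coordinates a))) (word-coordinates a)))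

  cells-surjective : ∀ {m} S → induced G S ≅ Q m →
                     ∃ λ N → N ℕ.+ m ≡ s × Σ (Tiling N p m) λ t → cells t ≡ S
  cells-surjective {m} S iso = conclude
    where
    open _≅_ iso
    module I = Inverse bijection

    f : Vec (Fin 2) m → Word
    f = encode ∘ value ∘ I.from

    f-injective : ∀ {u v} → f u ≡ f v → u ≡ v
    f-injective {u} {v} eq = trans (sym (I.strictlyInverseˡ u))
      (trans (cong I.to (value-injective (encode-injective eq))) (I.strictlyInverseˡ v))

    f-edge : ∀ {u v} → CubeEdge u v → WordEdge (f u) (f v)
    f-edge {u} {v} e = to (encode-edge _ _) (from (adjacency (I.from u) (I.from v))
      (subst₂ (λ u v → ∃! _≡_ λ i → lookup u i ≢ lookup v i)
        (sym (I.strictlyInverseˡ u)) (sym (I.strictlyInverseˡ v)) (CubeEdge⇒∃! e)))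

    cells≡ : ∀ {N} (t : Tiling N p m) → (∀ w → w ∈ t ⇔ ∃ λ u → f u ≡ w) → cells t ≡ S
    cells≡ t image = ⊆-antisym cells⊆S S⊆cells
      where
      cells⊆S : ∀ {i} → i ∈ₛ cells t → i ∈ₛ S
      cells⊆S {i} i∈ with u , eq ← to (image _) (to (∈-cells t i) i∈) =
        recompute (i ∈ₛ? S) (located (I.from u) (encode-injective eq))
        where
        located : (a : Graph.Vertex (induced G S)) → value a ≡ element i → i ∈ₛ S
        located (_ , [ v∈ ]) refl =
          subst (_∈ₛ S) (position-element i) (recompute (_ ∈ₛ? S) v∈)

      S⊆cells : ∀ {i} → i ∈ₛ S → i ∈ₛ cells t
      S⊆cells {i} i∈ = from (∈-cells t i) (from (image _)
        (I.to a , cong (encode ∘ value) (I.strictlyInverseʳ a)))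
        where
        a : Graph.Vertex (induced G S)
        a = element i , [ subst (_∈ₛ S) (sym (position-element i)) i∈ ]

    conclude : ∃ λ N → N ℕ.+ m ≡ s × Σ (Tiling N p m) λ t → cells t ≡ S
    -- The tiling comes with its own `p′` and `N`. Any one of its words encodes a vertex, whose
    -- letters `true` give `p′ ≡ p` and whose length gives `N + m ≡ s`.
    conclude with N , p′ , t , image ← cube⇒tiling f f-edge f-injective
      with _ , w∈ ← inhabited t
      with u , refl ← to (image _) w∈
      with refl ← trans (sym (∈-trues w∈)) (encode-trues (value (I.from u)))
      = N , trans (sym (∈-length w∈)) (encode-length (value (I.from u))) , t , cells≡ t image

  cubes↔tilings : ∀ {N} m → N ℕ.+ m ≡ s → [ S ∈ Subset order ∣ induced G S ≅ Q m ] ↔ Tiling N p m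
  cubes↔tilings {N} m N+m≡s = mk↔ₛ′ (proj₁ ∘ tilingOf) cube
    (λ t → cells-injective _ t N+m≡s (proj₂ (tilingOf (cube t))))
    (λ a → value-injective (proj₂ (tilingOf a)))
    where
    -- `cells-surjective` supplies its own number of tiles; cancelling `m` identifies it with `N`.
    resize : ∀ {S} → (∃ λ N′ → N′ ℕ.+ m ≡ s × Σ (Tiling N′ p m) λ t → cells t ≡ S) →
             Σ (Tiling N p m) λ t → cells t ≡ S
    resize (N′ , N′+m≡s , t) with refl ← ℕₚ.+-cancelʳ-≡ m N′ N (trans N′+m≡s (sym N+m≡s)) = t

    tilingOf : (a : [ S ∈ Subset order ∣ induced G S ≅ Q m ]) → Σ (Tiling N p m) λ t → cells t ≡ value a
    tilingOf (S , [ iso ]) = resize (cells-surjective S (recompute (induced G S ≅? Q m) iso))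

    cube : Tiling N p m → [ S ∈ Subset order ∣ induced G S ≅ Q m ]
    cube t = cells t , [ cells≅Q t N+m≡s ]

  cubeCount≡ : ∀ N m → N ℕ.+ m ≡ s → cubeCount m G ≡ (N C p) ℕ.* (p C m)
  cubeCount≡ N m N+m≡s = trans
    (↔⇒≡ (↔-trans (Finite.enum (inducedCubes G m))
           (↔-trans (cubes↔tilings m N+m≡s) (↔-sym (tilings N p m)))))
    (tilingCount≡ N p m)

  -- An `m`-cube would come from a tiling with `N + m ≡ s`, forcing `m ≤ s`.
  cubeCount≡0 : ∀ m → s < m → cubeCount m G ≡ 0
  cubeCount≡0 m s<m = ↔⇒≡ (↔-trans (Finite.enum (inducedCubes G m))
    (mk↔ₛ′ none (λ ()) (λ ()) (λ a → ⊥-elim (empty a))))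
    where
    empty : ¬ [ S ∈ Subset order ∣ induced G S ≅ Q m ]
    empty (S , [ iso ]) = too-long (cells-surjective S (recompute (induced G S ≅? Q m) iso))
      where
      too-long : ¬ (∃ λ N → N ℕ.+ m ≡ s × Σ (Tiling N p m) λ t → cells t ≡ S)
      too-long (N , refl , _) = ℕₚ.<⇒≱ s<m (ℕₚ.m≤n+m m N)

    none : [ S ∈ Subset order ∣ induced G S ≅ Q m ] → Fin 0
    none a = ⊥-elim (empty a)

-- Padovan words

-- The letters false and true stand for the blocks 01 and 011.
expand : Word → List (Fin 2)
expand []          = 0F ∷ []
expand (false ∷ b) = 0F ∷ 1F ∷ expand b
expand (true ∷ b)  = 0F ∷ 1F ∷ 1F ∷ expand b

-- The letter after 01 tells the blocks apart: 1 inside 011, otherwise the 0 that begins every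
-- expansion. The mixed cases split the tail to expose this 0.
expand-injective : ∀ b c → expand b ≡ expand c → b ≡ c
expand-injective []          []          _  = refl
expand-injective []          (false ∷ c) ()
expand-injective []          (true ∷ c)  ()
expand-injective (false ∷ b) []          ()
expand-injective (true ∷ b)  []          ()
expand-injective (false ∷ b) (false ∷ c) eq =
  cong (false ∷_) (expand-injective b c (∷-injectiveʳ (∷-injectiveʳ eq)))
expand-injective (true ∷ b)  (true ∷ c)  eq =
  cong (true ∷_) (expand-injective b c (∷-injectiveʳ (∷-injectiveʳ (∷-injectiveʳ eq))))
expand-injective (false ∷ [])          (true ∷ c) ()
expand-injective (false ∷ (false ∷ b)) (true ∷ c) ()
expand-injective (false ∷ (true ∷ b))  (true ∷ c) ()
expand-injective (true ∷ b) (false ∷ [])          ()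
expand-injective (true ∷ b) (false ∷ (false ∷ c)) ()
expand-injective (true ∷ b) (false ∷ (true ∷ c))  ()

expand-prefix : ∀ b → Prefix _≡_ (0F ∷ []) (expand b)
expand-prefix []          = refl ∷ []
expand-prefix (false ∷ b) = refl ∷ []
expand-prefix (true ∷ b)  = refl ∷ []

expand-suffix : ∀ b → Suffix _≡_ (0F ∷ []) (expand b)
expand-suffix []          = here (refl ∷ [])
expand-suffix (false ∷ b) = there (there (expand-suffix b))
expand-suffix (true ∷ b)  = there (there (there (expand-suffix b)))

expand-no-00 : ∀ b → ¬ (expand b hasSubword (0F ∷ 0F ∷ []))
expand-no-00 []          (here (_ ∷ ()))
expand-no-00 []          (there (here ()))
expand-no-00 (false ∷ b) (here (_ ∷ () ∷ _))
expand-no-00 (false ∷ b) (there (here (() ∷ _)))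
expand-no-00 (false ∷ b) (there (there i)) = expand-no-00 b i
expand-no-00 (true ∷ b)  (here (_ ∷ () ∷ _))
expand-no-00 (true ∷ b)  (there (here (() ∷ _)))
expand-no-00 (true ∷ b)  (there (there (here (() ∷ _))))
expand-no-00 (true ∷ b)  (there (there (there i))) = expand-no-00 b i

-- This excludes a subword 111 that runs over the end of a block.
expand-no-1-prefix : ∀ b {w} → ¬ Prefix _≡_ (1F ∷ w) (expand b)
expand-no-1-prefix []          (() ∷ _)
expand-no-1-prefix (false ∷ b) (() ∷ _)
expand-no-1-prefix (true ∷ b)  (() ∷ _)

expand-no-111 : ∀ b → ¬ (expand b hasSubword (1F ∷ 1F ∷ 1F ∷ []))
expand-no-111 [] (here (() ∷ _))
expand-no-111 [] (there (here ()))
expand-no-111 (false ∷ b) (here (() ∷ _))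
expand-no-111 (false ∷ b) (there (here (_ ∷ q))) = expand-no-1-prefix b q
expand-no-111 (false ∷ b) (there (there i)) = expand-no-111 b i
expand-no-111 (true ∷ b) (here (() ∷ _))
expand-no-111 (true ∷ b) (there (here (_ ∷ _ ∷ q))) = expand-no-1-prefix b q
expand-no-111 (true ∷ b) (there (there (here (_ ∷ q)))) = expand-no-1-prefix b q
expand-no-111 (true ∷ b) (there (there (there i))) = expand-no-111 b i

padovan-expand : ∀ b → Padovan (expand b)
padovan-expand b = expand-prefix b , expand-suffix b , expand-no-00 b , expand-no-111 b

drop-suffix : ∀ {x y z : Fin 2} {w} → Suffix _≡_ (z ∷ []) (x ∷ y ∷ w) → Suffix _≡_ (z ∷ []) (y ∷ w)
drop-suffix (here (_ ∷ ()))
drop-suffix (there suffix) = suffix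

no-0-suffix : ¬ Suffix (_≡_ {A = Fin 2}) (0F ∷ []) (1F ∷ [])
no-0-suffix (here (() ∷ _))
no-0-suffix (there (here ()))

-- Blocks are peeled off one at a time: without 00 a 1 follows each 0 but the last, without 111 at
-- most two do, and the final 0 keeps the word from ending in a block. The rest is again Padovan.
padovan⇒expand : ∀ w → Padovan w → ∃ λ b → w ≡ expand b
padovan⇒expand [] (() , _)
padovan⇒expand (1F ∷ w) (() ∷ _ , _)
padovan⇒expand (0F ∷ []) _ = [] , refl
padovan⇒expand (0F ∷ 0F ∷ w) (_ , _ , no00 , _) =
  contradiction (here (refl ∷ refl ∷ [])) no00
padovan⇒expand (0F ∷ 1F ∷ []) (_ , suffix , _) =
  contradiction (drop-suffix suffix) no-0-suffix
padovan⇒expand (0F ∷ 1F ∷ 0F ∷ w) (_ , suffix , no00 , no111)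
  with b , eq ← padovan⇒expand (0F ∷ w)
    (refl ∷ [] , drop-suffix (drop-suffix suffix) , (λ i → no00 (there (there i))) , λ i → no111 (there (there i)))
  = false ∷ b , cong (λ v → 0F ∷ 1F ∷ v) eq
padovan⇒expand (0F ∷ 1F ∷ 1F ∷ []) (_ , suffix , _) =
  contradiction (drop-suffix (drop-suffix suffix)) no-0-suffix
padovan⇒expand (0F ∷ 1F ∷ 1F ∷ 0F ∷ w) (_ , suffix , no00 , no111)
  with b , eq ← padovan⇒expand (0F ∷ w)
    ( refl ∷ [] , drop-suffix (drop-suffix (drop-suffix suffix))
    , (λ i → no00 (there (there (there i)))) , λ i → no111 (there (there (there i))) )
  = true ∷ b , cong (λ v → 0F ∷ 1F ∷ 1F ∷ v) eq
padovan⇒expand (0F ∷ 1F ∷ 1F ∷ 1F ∷ w) (_ , _ , _ , no111) =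
  contradiction (there (here (refl ∷ refl ∷ refl ∷ []))) no111

-- Edges between Padovan words as transpositions of blocks

data Swap : List (Fin 2) → List (Fin 2) → Set where
  here  : ∀ {w} → Swap (0F ∷ 1F ∷ w) (1F ∷ 0F ∷ w)
  there : ∀ {a u v} → Swap u v → Swap (a ∷ u) (a ∷ v)

Swap⇒⟶ : ∀ {u v} → Swap u v → u ⟶ v
Swap⇒⟶ here = [] , _ , refl , refl
Swap⇒⟶ (there s) with a , b , refl , refl ← Swap⇒⟶ s = _ ∷ a , b , refl , refl

⟶⇒Swap : ∀ {u v} → u ⟶ v → Swap u v
⟶⇒Swap ([]    , b , refl , refl) = here
⟶⇒Swap (_ ∷ a , b , refl , refl) = there (⟶⇒Swap (a , b , refl , refl))

-- 01011 becomes 01101 by replacing the 01 at its third and fourth letters with 10.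
expand-swap : ∀ {b c i} → b ⟨ i , ↑ ⟩ c → Swap (expand b) (expand c)
expand-swap up = there (there here)
expand-swap (skip {false} s) = there (there (expand-swap s))
expand-swap (skip {true} s)  = there (there (there (expand-swap s)))

skip-up : ∀ {a b c} → (∃ λ i → b ⟨ i , ↑ ⟩ c) → ∃ λ i → a ∷ b ⟨ i , ↑ ⟩ a ∷ c
skip-up (i , s) = suc i , skip s

swapped : ∀ {u v} → Swap (0F ∷ 1F ∷ u) (1F ∷ v) → 0F ∷ u ≡ v
swapped here = refl

-- A swap turns the first letter that it changes from 0 to 1, so the first blocks that differ are 01
-- in `b` and 011 in `c`. The next block of `b` must then be 011: after a block 01, or at the end of
-- `b`, no valid expansion results.
expand-swap⁻ : ∀ b c → Swap (expand b) (expand c) → ∃ λ i → b ⟨ i , ↑ ⟩ c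
expand-swap⁻ [] [] (there ())
expand-swap⁻ [] (false ∷ c) (there ())
expand-swap⁻ [] (true ∷ c) (there ())
expand-swap⁻ (false ∷ b) [] (there ())
expand-swap⁻ (true ∷ b) [] (there ())
expand-swap⁻ (false ∷ b) (false ∷ c) (there (there s)) = skip-up (expand-swap⁻ b c s)
expand-swap⁻ (true ∷ b) (true ∷ c) (there (there (there s))) = skip-up (expand-swap⁻ b c s)
expand-swap⁻ (true ∷ b) (false ∷ []) (there (there ()))
expand-swap⁻ (true ∷ b) (false ∷ false ∷ c) (there (there ()))
expand-swap⁻ (true ∷ b) (false ∷ true ∷ c) (there (there ()))
expand-swap⁻ (false ∷ []) (true ∷ c) (there (there ()))
expand-swap⁻ (false ∷ false ∷ b) (true ∷ c) (there (there s)) =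
  contradiction (subst (_hasSubword _) (swapped s) (here (refl ∷ expand-prefix b))) (expand-no-00 c)
expand-swap⁻ (false ∷ true ∷ b) (true ∷ c) (there (there s))
  with refl ← expand-injective (false ∷ b) c (swapped s) = 0 , up

-- Each block has one 0, and one or two letters 1; the closing 0 gives the `suc`. A vector `w`
-- appears because `ones` counts in vectors.
padovan-expand-length : ∀ b {n} (w : Vec (Fin 2) n) → toList w ≡ expand b →
  n ≡ suc (length b ℕ.+ (length b ℕ.+ trues b)) × ones w ≡ length b ℕ.+ trues b
padovan-expand-length [] (0F ∷ []) refl = refl , refl
padovan-expand-length (false ∷ b) (x ∷ y ∷ w) eq
  with refl , eq ← ∷-injective eq
  with refl , eq ← ∷-injective eq
  with n≡ , ones≡ ← padovan-expand-length b w eq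
  = cong (2 ℕ.+_) (trans n≡ (sym (ℕₚ.+-suc (length b) _))) , cong suc ones≡
padovan-expand-length (true ∷ b) (x ∷ y ∷ z ∷ w) eq
  with refl , eq ← ∷-injective eq
  with refl , eq ← ∷-injective eq
  with refl , eq ← ∷-injective eq
  with n≡ , ones≡ ← padovan-expand-length b w eq
  = trans (cong (3 ℕ.+_) n≡) (lemma (length b) (trues b))
  , trans (cong (2 ℕ.+_) ones≡) (cong suc (sym (ℕₚ.+-suc (length b) _)))
  where
  lemma : ∀ l t → 3 ℕ.+ suc (l ℕ.+ (l ℕ.+ t)) ≡ suc (suc l ℕ.+ (suc l ℕ.+ suc t))
  lemma = ℕ-Solver.solve-∀

fromListOf : ∀ {A : Set} {n} (xs : List A) → n ≡ length xs → ∃ λ (v : Vec A n) → toList v ≡ xs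
fromListOf xs refl = fromList xs , toList∘fromList xs

expand-length : ∀ b → length (expand b) ≡ suc (length b ℕ.+ (length b ℕ.+ trues b))
expand-length b = proj₁ (padovan-expand-length b (fromList (expand b)) (toList∘fromList (expand b)))

-- With `s` blocks, `p` of them 011, a word has `s + 1` zeros and `s + p` ones. Writing `n` and `k`
-- in these terms avoids subtraction.
Φ-model : ∀ s p → WordModel (Φ (suc (s ℕ.+ (s ℕ.+ p))) (s ℕ.+ p)) s p
Φ-model s p = record
  { encode           = encode
  ; encode-injective = λ {u} {v} eq → value-injective (trans (sym (cast-is-id refl (value u)))
      (toList-injective refl (value u) (value v)
        (trans (expand-encode u) (trans (cong expand eq) (sym (expand-encode v))))))
  ; encode-length    = encode-length
  ; encode-trues     = λ v → ℕₚ.+-cancelˡ-≡ s _ _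
      (trans (cong (ℕ._+ trues (encode v)) (sym (encode-length v)))
             (trans (sym (ones-encode v)) (proj₂ (letters v))))
  ; decode           = decode
  ; encode-edge      = λ u v → mk⇔ (edge⁺ {u} {v}) (edge⁻ {u} {v})
  }
  where
  n : ℕ
  n = suc (s ℕ.+ (s ℕ.+ p))

  Vertex : Set
  Vertex = Graph.Vertex (Φ n (s ℕ.+ p))

  letters : (v : Vertex) → Padovan (toList (value v)) × ones (value v) ≡ s ℕ.+ p
  letters (w , [ q ]) = recompute (Padovan? (toList w) ×-dec (ones w ℕₚ.≟ s ℕ.+ p)) q

  encode : Vertex → Word
  encode v = proj₁ (padovan⇒expand _ (proj₁ (letters v)))

  expand-encode : ∀ v → toList (value v) ≡ expand (encode v)
  expand-encode v = proj₂ (padovan⇒expand _ (proj₁ (letters v)))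

  ones-encode : ∀ v → ones (value v) ≡ length (encode v) ℕ.+ trues (encode v)
  ones-encode v = proj₂ (padovan-expand-length (encode v) (value v) (expand-encode v))

  encode-length : ∀ v → length (encode v) ≡ s
  -- Removing the `s + p` ones and the closing 0 from the length leaves one 0 for each block.
  encode-length v = sym (ℕₚ.+-cancelʳ-≡ (s ℕ.+ p) s _ (trans
    (ℕₚ.suc-injective (proj₁ (padovan-expand-length (encode v) (value v) (expand-encode v))))
    (cong (length (encode v) ℕ.+_) (trans (sym (ones-encode v)) (proj₂ (letters v))))))

  decode : ∀ b → length b ≡ s → trues b ≡ p → ∃ λ v → encode v ≡ b
  decode b refl refl = v , expand-injective _ b (trans (sym (expand-encode v)) w≡)
    where
    w : Vec (Fin 2) n
    w = proj₁ (fromListOf (expand b) (sym (expand-length b)))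

    w≡ : toList w ≡ expand b
    w≡ = proj₂ (fromListOf (expand b) (sym (expand-length b)))

    v : Vertex
    v = w , [ subst Padovan (sym w≡) (padovan-expand b) , proj₂ (padovan-expand-length b w w≡) ]

  edge⁺ : ∀ {u v} → Graph._~_ (Φ n (s ℕ.+ p)) u v → WordEdge (encode u) (encode v)
  edge⁺ {u} {v} (fwd e) with i , s ← expand-swap⁻ _ _
    (⟶⇒Swap (subst₂ _⟶_ (expand-encode u) (expand-encode v) e)) = i , ↑ , s
  edge⁺ {u} {v} (bwd e) with i , s ← expand-swap⁻ _ _
    (⟶⇒Swap (subst₂ _⟶_ (expand-encode v) (expand-encode u) e)) = i , ↓ , reverse s

  edge⁻ : ∀ {u v} → WordEdge (encode u) (encode v) → Graph._~_ (Φ n (s ℕ.+ p)) u v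
  edge⁻ {u} {v} (i , ↑ , s) = fwd
    (subst₂ _⟶_ (sym (expand-encode u)) (sym (expand-encode v)) (Swap⇒⟶ (expand-swap s)))
  edge⁻ {u} {v} (i , ↓ , s) = bwd
    (subst₂ _⟶_ (sym (expand-encode v)) (sym (expand-encode u)) (Swap⇒⟶ (expand-swap (reverse s))))

-- Parameters and binomial coefficients

-- The upper bound on `k` makes s = n - k - 1 nonnegative, the lower bound p = 2k - n + 1.
parameters : ∀ n k → 1 ≤ n → n / 2 ≤ k → k ≤ (2 ℕ.* n ∸ 2) / 3 →
             ∃₂ λ s p → n ≡ suc (s ℕ.+ (s ℕ.+ p)) × k ≡ s ℕ.+ p
parameters (suc n) k _ n/2≤k k≤ =
  -- Here `n` is one less than the length of the words, so these are s and p.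
  n ∸ k , k ∸ (n ∸ k) ,
  cong suc (trans (sym (ℕₚ.m∸n+n≡m k≤n)) (cong ((n ∸ k) ℕ.+_) k≡)) , k≡
  where
  open ℕₚ.≤-Reasoning

  3k≤2n : k ℕ.* 3 ≤ n ℕ.* 2
  3k≤2n = begin
    k ℕ.* 3 ≤⟨ ℕₚ.*-monoˡ-≤ 3 k≤ ⟩
    (2 ℕ.* suc n ∸ 2) / 3 ℕ.* 3 ≤⟨ DivMod.m/n*n≤m (2 ℕ.* suc n ∸ 2) 3 ⟩
    2 ℕ.* suc n ∸ 2 ≡⟨ cong (_∸ 2) (ℕₚ.*-comm 2 (suc n)) ⟩
    n ℕ.* 2 ∎

  k≤n : k ≤ n
  k≤n = ℕₚ.*-cancelʳ-≤ k n 2 (ℕₚ.≤-trans (ℕₚ.*-monoʳ-≤ k (ℕₚ.n≤1+n 2)) 3k≤2n)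

  n≤k+k : n ≤ k ℕ.+ k
  -- The remainder modulo 2 may be 1, so only `suc n ≤ 1 + 2k` follows, which is just enough.
  n≤k+k = s≤s⁻¹ (s≤s⁻¹ (begin-strict
    suc n ≡⟨ DivMod.m≡m%n+[m/n]*n (suc n) 2 ⟩
    suc n % 2 ℕ.+ suc n / 2 ℕ.* 2 <⟨ ℕₚ.+-mono-<-≤ (DivMod.m%n<n (suc n) 2) (ℕₚ.*-monoˡ-≤ 2 n/2≤k) ⟩
    2 ℕ.+ k ℕ.* 2 ≡⟨ cong (2 ℕ.+_) (trans (ℕₚ.*-comm k 2) (cong (k ℕ.+_) (ℕₚ.+-identityʳ k))) ⟩
    2 ℕ.+ (k ℕ.+ k) ∎))

  k≡ : k ≡ (n ∸ k) ℕ.+ (k ∸ (n ∸ k))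
  k≡ = sym (ℕₚ.m+[n∸m]≡n (ℕₚ.m≤n+o⇒m∸n≤o n k n≤k+k))

-- The arguments of the binomial coefficients for n = 1 + s + (s + p) and
-- k = s + p: upper has s = a + c and j = c, upper⁻ has s = a and j = 1 + s + c.
upper : ∀ a b c → (1ℤ + ((a + c) + ((a + c) + b))) - ((a + c) + b) - c - 1ℤ ≡ a
upper = ℤ-Solver.solve-∀

upper⁻ : ∀ a b c → (1ℤ + (a + (a + b))) - (a + b) - (1ℤ + (a + c)) - 1ℤ ≡ - (1ℤ + c)
upper⁻ = ℤ-Solver.solve-∀

lower : ∀ a b → ((a + b) + ((a + b) + 0ℤ)) - (1ℤ + (a + (a + b))) + 1ℤ ≡ b
lower = ℤ-Solver.solve-∀

FormulaHolds : (n k j : ℕ) → Set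
FormulaHolds n k j = cubeCount j (Φ n k) ≡
  ((+ n - + k - + j - + 1) choose (+ (2 ℕ.* k) - + n + + 1)) ℕ.*
  ((+ (2 ℕ.* k) - + n + + 1) choose (+ j))

-- Sums of nonnegative integers compute to `+_` of natural sums, so `upper` and `lower` fit as they
-- stand; the `0ℤ` in `lower` comes from unfolding `2 ℕ.* k`.
formula-within : ∀ s p j N → N ℕ.+ j ≡ s → FormulaHolds (suc (s ℕ.+ (s ℕ.+ p))) (s ℕ.+ p) j
formula-within s p j N refl = trans (CubeCount.cubeCount≡ (Φ-model s p) N j refl)
  (sym (cong₂ (λ a b → (a choose b) ℕ.* (b choose (+ j)))
    (upper (+ N) (+ p) (+ j)) (lower (+ s) (+ p))))

-- For `j > s` there are no cubes, and n - k - j - 1 is negative, where `_choose_` is 0 by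
-- definition.
formula-beyond : ∀ s p j r → suc s ℕ.+ r ≡ j → FormulaHolds (suc (s ℕ.+ (s ℕ.+ p))) (s ℕ.+ p) j
formula-beyond s p j r refl = trans (CubeCount.cubeCount≡0 (Φ-model s p) j (ℕₚ.m≤m+n (suc s) r))
  (sym (cong (λ a → (a choose b) ℕ.* (b choose (+ j))) (upper⁻ (+ s) (+ p) (+ r))))
  where
  b : ℤ
  b = + (2 ℕ.* (s ℕ.+ p)) - + suc (s ℕ.+ (s ℕ.+ p)) + + 1

formula : ∀ {n k} → (∃₂ λ s p → n ≡ suc (s ℕ.+ (s ℕ.+ p)) × k ≡ s ℕ.+ p) → ∀ j → FormulaHolds n k j
formula (s , p , refl , refl) j = [ (λ j≤s → formula-within s p j (s ∸ j) (ℕₚ.m∸n+n≡m j≤s))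
  , (λ s<j → formula-beyond s p j (j ∸ suc s) (ℕₚ.m+[n∸m]≡n s<j)) ]′ (ℕₚ.≤-<-connex j s)

theorem5p2 : (n k : ℕ) →
    1 ≤ n →
    n / 2 ≤ k →
    k ≤ (2 ℕ.* n ∸ 2) / 3 →
    cubePolynomial (Φ n k) ≈
    polynomial
    (λ j → ((+ n - + k - + j - + 1) choose (+ (2 ℕ.* k) - + n + + 1))
    ℕ.* ((+ (2 ℕ.* k) - + n + + 1) choose (+ j)))
    (choose-support
    (λ j → (+ n - + k - + j - + 1) choose (+ (2 ℕ.* k) - + n + + 1))
    (+ (2 ℕ.* k) - + n + + 1))
theorem5p2 n k 1≤n n/2≤k k≤ = formula (parameters n k 1≤n n/2≤k k≤)
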